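{- Let $X$ be a set of $n$ points with similarity function $S$, and suppose the target clustering $\mathcal{C}^{\ast}=\{C^{\ast}_1,\dots,C^{\ast}_k\}$ satisfies stability with respect to $S$. Let $\eta>0.5$, and suppose the initial clustering has overclustering error $\delta_o$ and underclustering error $\delta_u$. Then in the $\eta$-merge model, the interactive algorithm using the global split procedure and the global $\eta$-merge procedure (described below) requires at most $\delta_o$ split requests and $2(\delta_u+k)\log_{\frac{1}{1-\eta}} n$ merge requests to find the target clustering.
   Context: A clustering of $X$ is a partition into nonempty clusters. For clusterings $\mathcal{C},\mathcal{C}'$, $\mathrm{dist}(\mathcal{C},\mathcal{C}')=\sum_{A\in\mathcal{C}}(|\{B\in\mathcal{C}':B\cap A\neq\emptyset\}|-1)$; for the initial clustering $\mathcal{C}$, $\delta_u=\mathrm{dist}(\mathcal{C}^{\ast},\mathcal{C})$ and $\delta_o=\mathrm{dist}(\mathcal{C},\mathcal{C}^{\ast})$. For nonempty $A,A'\subseteq X$ let $S(A,A')$ be the average of $S(x,y)$ over $x\in A$, $y\in A'$. $\mathcal{C}^{\ast}$ satisfies stability w.r.t. $S$ if for all $i\neq j$, every nonempty proper subset $A\subset C^{\ast}_i$ and every nonempty $A'\subseteq C^{\ast}_j$: $S(A,C^{\ast}_i\setminus A)>S(A,A')$. Average-linkage tree $T_{glob}$: start with the singletons $\{x\}$, $x\in X$, as leaves; repeatedly merge the two current nodes $N_1,N_2$ with largest $S(N_1,N_2)$ (ties arbitrary) into a parent node $N_1\cup N_2$, until a single root $X$ remains. Nodes are identified with their point sets. Interactive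 process ($\eta$-merge model): start from the initial clustering, every cluster labelled "impure". At each step an oracle issues either split$(C_i)$, allowed only if the current cluster $C_i$ contains points from two or more target clusters, or merge$(C_i,C_j)$ for distinct current clusters, allowed only if there is a target cluster $C^{\ast}_l$ with $|C_i\cap C^{\ast}_l|\ge\eta|C_i|$ and $|C_j\cap C^{\ast}_l|\ge\eta|C_j|$. The algorithm then only changes assignments of points in the requested cluster(s): Split procedure: let $N$ be the node of $T_{glob}$ at which the points of $C_i$ are first split in two (the deepest node containing $C_i$), with children $N_1,N_2$; replace $C_i$ by $C_i\cap N_1$ and $C_i\cap N_2$, both labelled "impure". Merge procedure: set $\eta_1=1$ if $C_i$ is labelled "pure" and $\eta_1=\eta$ otherwise; define $\eta_2$ likewise for $C_j$. Find a node $N$ of $T_{glob}$ of maximal depth with $|N\cap C_i|\ge\eta_1|C_i|$ and $|N\cap C_j|\ge\eta_2|C_j|$. Replace $C_i$ by $C_i\setminus N$ and $C_j$ by $C_j\setminus N$ (keeping their labels; empty clusters are discarded), and add a new cluster $N\cap(C_i\cup C_j)$ labelled "pure". "Finding the target clustering" means the current clustering becomes equal to $\mathcal{C}^{\ast}$; the bounds hold for any sequence of allowed requests.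
   Formalization: S is taken symmetric and η < 1. The stated merge bound is proved when 1/(1-η) ≤ n² (it fails e.g. for n = 2, η = 0.99, target {X}, singletons initially); for all η the bound 2(δ_u+k)⌈log_{1/(1-η)} n⌉ is proved. -}

module Defs where

open import Level using (Level; _⊔_) renaming (suc to lsuc)
open import Algebra.Bundles using (CommutativeRing)
open import Algebra.Structures using (IsCommutativeRing)
import Algebra.Properties.Semiring.Exp as Exp
import Algebra.Properties.Semiring.Sum as Sum
import Algebra.Properties.Semiring.Mult as Mult
open import Data.Bool.Base using (if_then_else_)
open import Data.Fin.Base using (Fin)
open import Data.Fin.Subset
  using (Subset; ⁅_⁆; _∩_; _∪_; _─_; _⊆_; _⊂_; ∣_∣; Nonempty; Empty)
  renaming (_∈_ to _∈ˢ_)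
open import Data.Fin.Subset.Properties using (nonempty?)
open import Data.List.Base using (List; []; _∷_; [_]; _++_; map; filter; length; sum; allFin)
open import Data.List.Membership.Propositional using (_∈_)
open import Data.List.Relation.Binary.Permutation.Propositional using (_↭_)
open import Data.List.Relation.Unary.All using (All)
open import Data.List.Relation.Unary.Any using (Any)
open import Data.List.Relation.Unary.AllPairs using (AllPairs)
open import Data.Nat.Base as ℕ using (ℕ; suc; _∸_)
open import Data.Product.Base using (∃-syntax; _×_; _,_; proj₁; proj₂)
open import Data.Vec.Base using (lookup)
open import Relation.Binary.Core using (Rel)
open import Relation.Binary.Construct.Closure.ReflexiveTransitive using (Star)
import Relation.Binary.Construct.StrictToNonStrict as StrictToNonStrict
open import Relation.Binary.PropositionalEquality.Core using (_≢_)
open import Relation.Binary.Structures using (IsStrictTotalOrder)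
open import Relation.Nullary using (¬_)

-- The real numbers of the classical theory are one instance.

record OrderedField (c ℓ₁ ℓ₂ : Level) : Set (lsuc (c ⊔ ℓ₁ ⊔ ℓ₂)) where
  infix  8 _⁻¹
  infix  8 -_
  infixl 7 _*_
  infixl 6 _+_
  infix  4 _≈_ _<_
  field
    Carrier            : Set c
    _≈_                : Rel Carrier ℓ₁
    _<_                : Rel Carrier ℓ₂
    _+_ _*_            : Carrier → Carrier → Carrier
    -_                 : Carrier → Carrier
    0# 1#              : Carrier
    -- The value at 0# is unconstrained.
    _⁻¹                : Carrier → Carrier
    isCommutativeRing  : IsCommutativeRing _≈_ _+_ _*_ -_ 0# 1#
    isStrictTotalOrder : IsStrictTotalOrder _≈_ _<_
    ⁻¹-inverseʳ        : ∀ x → ¬ (x ≈ 0#) → x * x ⁻¹ ≈ 1#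
    0<1                : 0# < 1#
    +-monoˡ-<          : ∀ z {x y} → x < y → x + z < y + z
    *-pos              : ∀ {x y} → 0# < x → 0# < y → 0# < x * y

  commutativeRing : CommutativeRing c ℓ₁
  commutativeRing = record { isCommutativeRing = isCommutativeRing }

  open CommutativeRing commutativeRing using (semiring; _-_) public
  open StrictToNonStrict _≈_ _<_ using (_≤_) public
  open Exp semiring using (_^_) public
  open Mult semiring using () renaming (_×_ to _·_)
  open Sum semiring using () renaming (sum to ∑) public

  fromℕ : ℕ → Carrier
  fromℕ m = m · 1#

  ½ : Carrier
  ½ = fromℕ 2 ⁻¹

  -- Logarithms are not available in an ordered field.  For 1# < b and 1 ≤ n,
  -- the inequality m ≤ q log_b n is expressed by exponentiating both sides.
  infix 4 _≤_·log[_]_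
  _≤_·log[_]_ : ℕ → ℕ → Carrier → ℕ → Set (ℓ₁ ⊔ ℓ₂)
  m ≤ q ·log[ b ] n = b ^ m ≤ fromℕ n ^ q

  -- L = ⌈log_b n⌉, the least natural number with log_b n ≤ L.
  infix 4 _≡⌈log[_]_⌉
  _≡⌈log[_]_⌉ : ℕ → Carrier → ℕ → Set (ℓ₁ ⊔ ℓ₂)
  L ≡⌈log[ b ] n ⌉ =
    (fromℕ n ≤ b ^ L) × (∀ L′ → fromℕ n ≤ b ^ L′ → L ℕ.≤ L′)

-- Clusters occur once each, since they are nonempty and pairwise disjoint; two
-- clusterings are therefore equal when their lists are permutations.

record Clustering (n : ℕ) : Set where
  field
    clusters : List (Subset n)
    nonempty : All Nonempty clusters
    disjoint : AllPairs (λ A B → Empty (A ∩ B)) clusters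
    covering : ∀ x → Any (x ∈ˢ_) clusters

open Clustering public

#_ : ∀ {n} → Clustering n → ℕ
# C = length (clusters C)

-- The subtraction is never truncated: a nonempty A meets some cluster of C′.
dist : ∀ {n} → Clustering n → Clustering n → ℕ
dist C C′ =
  sum (map (λ A → length (filter (λ B → nonempty? (B ∩ A)) (clusters C′)) ∸ 1)
           (clusters C))

data Tree (n : ℕ) : Set where
  leaf : Fin n → Tree n
  node : Tree n → Tree n → Tree n

points : ∀ {n} → Tree n → Subset n
points (leaf x)     = ⁅ x ⁆
points (node t₁ t₂) = points t₁ ∪ points t₂

-- NodeAt T d N: N is (the subtree rooted at) a node of T at distance d from the root.
data NodeAt {n : ℕ} : Tree n → ℕ → Tree n → Set where
  here  : ∀ {t} → NodeAt t 0 t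
  left  : ∀ {t₁ t₂ d s} → NodeAt t₁ d s → NodeAt (node t₁ t₂) (suc d) s
  right : ∀ {t₁ t₂ d s} → NodeAt t₂ d s → NodeAt (node t₁ t₂) (suc d) s

-- N is a node of T of maximal depth among those whose point set satisfies P.
IsDeepest : ∀ {n} {ℓ : Level} → Tree n → (Subset n → Set ℓ) → Tree n → Set ℓ
IsDeepest T P N =
  ∃[ d ] NodeAt T d N × P (points N) ×
    (∀ d′ N′ → NodeAt T d′ N′ → P (points N′) → d′ ℕ.≤ d)

data Label : Set where
  pure impure : Label

LabelledCluster : ℕ → Set
LabelledCluster n = Subset n × Label

State : ℕ → Set
State n = List (LabelledCluster n)

initial : ∀ {n} → Clustering n → State n
initial C = map (_, impure) (clusters C)

_is_ : ∀ {n} → State n → Clustering n → Set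
σ is C = map proj₁ σ ↭ clusters C

discardEmpty : ∀ {n} → State n → State n
discardEmpty = filter (λ c → nonempty? (proj₁ c))

data Request (n : ℕ) : Set where
  split : LabelledCluster n → Request n
  merge : LabelledCluster n → LabelledCluster n → Request n

module _ {c ℓ₁ ℓ₂ : Level} (F : OrderedField c ℓ₁ ℓ₂) where
  open OrderedField F

  module Similarity {n : ℕ} (S : Fin n → Fin n → Carrier) where

    Symmetric : Set ℓ₁
    Symmetric = ∀ x y → S x y ≈ S y x

    -- The average of S over A × B; meaningful for nonempty A and B.
    average : Subset n → Subset n → Carrier
    average A B =
      ∑ (λ x → ∑ (λ y → if lookup A x then (if lookup B y then S x y else 0#) else 0#))
        * fromℕ (∣ A ∣ ℕ.* ∣ B ∣) ⁻¹

    Stable : Clustering n → Set ℓ₂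
    Stable C* =
      ∀ {C C′} → C ∈ clusters C* → C′ ∈ clusters C* → C ≢ C′ →
      ∀ A → Nonempty A → A ⊂ C →
      ∀ A′ → Nonempty A′ → A′ ⊆ C′ →
      average A A′ < average A (C ─ A)

    -- The permutations pick two distinct current nodes.
    data _⟶_ : List (Tree n) → List (Tree n) → Set (ℓ₁ ⊔ ℓ₂) where
      link : ∀ {f t₁ t₂ rest} →
             f ↭ t₁ ∷ t₂ ∷ rest →
             (∀ {s₁ s₂ rest′} → f ↭ s₁ ∷ s₂ ∷ rest′ →
               average (points s₁) (points s₂) ≤ average (points t₁) (points t₂)) →
             f ⟶ (node t₁ t₂ ∷ rest)

    IsAverageLinkageTree : Tree n → Set (ℓ₁ ⊔ ℓ₂)
    IsAverageLinkageTree T = Star _⟶_ (map leaf (allFin n)) [ T ]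

  module MergeModel {n : ℕ} (C* : Clustering n) (T : Tree n) (η : Carrier) where

    -- At least a θ-fraction of C lies in A.
    Covers : Carrier → Subset n → Subset n → Set (ℓ₁ ⊔ ℓ₂)
    Covers θ A C = θ * fromℕ ∣ C ∣ ≤ fromℕ ∣ A ∩ C ∣

    threshold : Label → Carrier
    threshold pure   = 1#
    threshold impure = η

    data Allowed (σ : State n) : Request n → Set (ℓ₁ ⊔ ℓ₂) where
      split : ∀ {C l A B} → (C , l) ∈ σ →
              A ∈ clusters C* → B ∈ clusters C* → A ≢ B →
              Nonempty (C ∩ A) → Nonempty (C ∩ B) →
              Allowed σ (split (C , l))
      merge : ∀ {C₁ l₁ C₂ l₂ A} → (C₁ , l₁) ∈ σ → (C₂ , l₂) ∈ σ → C₁ ≢ C₂ →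
              A ∈ clusters C* → Covers η A C₁ → Covers η A C₂ →
              Allowed σ (merge (C₁ , l₁) (C₂ , l₂))

    -- Response σ r σ′: answering request r in σ can produce σ′.
    data Response (σ : State n) : Request n → State n → Set (ℓ₁ ⊔ ℓ₂) where
      split : ∀ {C l rest N₁ N₂} → σ ↭ (C , l) ∷ rest →
              IsDeepest T (C ⊆_) (node N₁ N₂) →
              Response σ (split (C , l))
                ((C ∩ points N₁ , impure) ∷ (C ∩ points N₂ , impure) ∷ rest)
      merge : ∀ {C₁ l₁ C₂ l₂ rest N} → σ ↭ (C₁ , l₁) ∷ (C₂ , l₂) ∷ rest →
              IsDeepest T (λ P → Covers (threshold l₁) P C₁ × Covers (threshold l₂) P C₂) N →
              Response σ (merge (C₁ , l₁) (C₂ , l₂))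
                ((points N ∩ (C₁ ∪ C₂) , pure)
                  ∷ discardEmpty ((C₁ ─ points N , l₁) ∷ (C₂ ─ points N , l₂) ∷ [])
                  ++ rest)

    -- Run C₀ s m σ: some sequence of allowed requests, s of them splits and m of
    -- them merges, leads from the initial clustering C₀ to σ.
    data Run (C₀ : Clustering n) : ℕ → ℕ → State n → Set (ℓ₁ ⊔ ℓ₂) where
      start : Run C₀ 0 0 (initial C₀)
      split : ∀ {s m σ σ′ c₁} → Run C₀ s m σ →
              Allowed σ (split c₁) → Response σ (split c₁) σ′ →
              Run C₀ (suc s) m σ′
      merge : ∀ {s m σ σ′ c₁ c₂} → Run C₀ s m σ →
              Allowed σ (merge c₁ c₂) → Response σ (merge c₁ c₂) σ′ →
              Run C₀ s (suc m) σ′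

module Submission where

-- Stability makes every node of the average-linkage tree laminar with respect to
-- the target clustering: it lies inside one target cluster or is a union of target
-- clusters.  Consequently a split separates whole target clusters and lowers dist(·, C*)
-- by at least one, a merge never raises it, and the cluster added by a merge lies inside
-- a target cluster.  For the merges, give an impure cluster C the weight
-- (1 + ⌊log_b ∣ C ∣⌋) times the number of target clusters it meets and a pure cluster
-- the weight 1.  A merge shrinks each impure cluster involved by a factor b = 1/(1 - η)
-- and absorbs each pure one, so both clusters lose at least 1, while the new pure cluster
-- adds only 1.

open import Defs
open import Algebra.Bundles using (CommutativeRing)
import Algebra.Properties.Semiring.Exp as Exp
import Algebra.Properties.Semiring.Mult as Mult
import Algebra.Properties.Semiring.Sum as Sum
open import Data.Bool.Base using (true; false; if_then_else_)
import Data.Bool.Properties as Bool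
open import Data.Empty using (⊥-elim)
open import Data.Fin.Base using (Fin; zero; suc)
open import Data.Fin.Subset
  using (Subset; inside; outside; ⁅_⁆; _∩_; _∪_; _─_; _⊆_; _⊂_; ∣_∣; Nonempty; Empty)
  renaming (_∈_ to _∈ˢ_; _∉_ to _∉ˢ_; ⊥ to ∅)
open import Data.Fin.Subset.Properties
open import Data.List.Base using (List; []; _∷_; _++_; map; filter; length; allFin)
open import Data.List.Properties using (map-∘; map-++)
open import Data.List.Membership.Propositional using (_∈_; find; lose)
open import Data.List.Membership.Propositional.Properties
  using (∈-∃++; ∈-allFin; ∈-map⁺; ∈-map⁻; ∈-filter⁺; ∈-++⁺ˡ)
open import Data.List.Membership.Propositional.Properties.WithK using (unique∧set⇒bag)
open import Data.List.Relation.Binary.BagAndSetEquality using (∼bag⇒↭)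
open import Data.List.Relation.Binary.Permutation.Propositional
  using (_↭_; ↭-trans; ↭-prep; ↭-swap; ↭-refl; ↭⇒↭ₛ)
open import Data.List.Relation.Binary.Permutation.Propositional.Properties
  using (shift; ∈-resp-↭; All-resp-↭; Any-resp-↭; map⁺)
import Data.List.Relation.Binary.Permutation.Setoid.Properties as ↭ₛ
open import Data.List.Relation.Unary.All as All using (All; []; _∷_)
import Data.List.Relation.Unary.All.Properties as All
open import Data.List.Relation.Unary.AllPairs as AllPairs using (AllPairs; []; _∷_)
import Data.List.Relation.Unary.AllPairs.Properties as AllPairs
open import Data.List.Relation.Unary.Any as Any using (Any; here; there; any?)
import Data.List.Relation.Unary.Any.Properties as Any
open import Data.List.Relation.Unary.Unique.Propositional using (Unique)
open import Data.List.Relation.Unary.Unique.Propositional.Properties using (allFin⁺)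
open import Data.Nat.Base as ℕ using (ℕ; zero; suc; _∸_; z≤n; s≤s)
open import Data.Nat.ListAction using (sum)
open import Data.Nat.ListAction.Properties using (sum-↭; sum-++)
import Data.Nat.Properties as ℕ
open import Data.Product.Base using (∃-syntax; _×_; _,_; proj₁; proj₂)
open import Data.Sum.Base using (_⊎_; inj₁; inj₂)
open import Data.Unit.Base using (⊤; tt)
open import Data.Vec.Base using ([]; _∷_; here; there; lookup)
import Data.Vec.Properties as Vec
open import Function.Base using (_∘_; case_of_)
open import Function.Bundles using (mk⇔)
open import Level using (Level; _⊔_)
open import Relation.Binary.Bundles using (StrictTotalOrder)
import Relation.Binary.Construct.StrictToNonStrict as StrictToNonStrict
open import Relation.Binary.Construct.Closure.ReflexiveTransitive using (Star; ε; _◅_)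
open import Relation.Binary.Core using (Rel)
open import Relation.Binary.Definitions using (tri<; tri≈; tri>)
  renaming (Symmetric to SymmetricRel)
open import Relation.Binary.PropositionalEquality
  using (_≡_; _≢_; refl; sym; trans; cong; cong₂; subst; setoid; resp₂; module ≡-Reasoning)
import Relation.Binary.Reasoning.StrictPartialOrder as StrictReasoning
open import Relation.Nullary using (¬_; Dec; yes; no)
open import Relation.Nullary.Decidable using (¬?; _×-dec_)
open import Relation.Unary using (Pred; Decidable)

-- Ordered fields

-- The bound `2 (δᵤ + k) log_b n` fails as a real number when `b` is large: with two points, one
-- target cluster and two initial singletons, one merge is needed, while the bound is `4 log_b 2`,
-- which is below 1 for `b > 16`. What the weights give is `m ≤ (δᵤ + k) (1 + ⌊log_b n⌋)`, because
-- even a one-point cluster can take part in a merge. The factor 2 absorbs the added 1 if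
-- `1 ≤ 2 log_b n`, or if the logarithm is rounded up; hence the two forms of the merge bound.
--
-- The condition `η > ½` enters twice. Two sets that each hold an `η`-fraction of the same cluster
-- share a point, which ties the node chosen by a merge to the target named by the oracle. It also
-- gives `b ≥ 2`, so that powers of `b` outgrow the natural numbers in any ordered field,
-- Archimedean or not.
--
-- Counting requests alone does not show that the target is found; this follows because every state
-- other than the target admits a request, and every allowed request has an answer.

least : ∀ {p} {P : ℕ → Set p} → (∀ t → Dec (P t)) → ∀ {m} → P m →
        ∃[ t ] P t × (∀ t′ → P t′ → t ℕ.≤ t′)
least {P = P} P? {zero} p₀ = zero , p₀ , λ _ _ → z≤n
least {P = P} P? {suc m} pₘ with P? zero
... | yes p₀ = zero , p₀ , λ _ _ → z≤n
... | no ¬p₀ with least {P = λ t → P (suc t)} (λ t → P? (suc t)) {m} pₘ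
...   | t , p , minimal = suc t , p , λ where
          zero     p′ → ⊥-elim (¬p₀ p′)
          (suc t′) p′ → s≤s (minimal t′ p′)

module OrderedFieldProperties {c ℓ₁ ℓ₂ : Level} (F : OrderedField c ℓ₁ ℓ₂) where
  open OrderedField F
  open CommutativeRing commutativeRing public
    using ( +-cong; +-congˡ; +-congʳ; +-comm; +-assoc; +-identityˡ; +-identityʳ
          ; *-congˡ; *-congʳ; *-comm; *-assoc; *-identityˡ; *-identityʳ
          ; zeroˡ; zeroʳ; distribˡ; distribʳ; -‿inverseˡ )
    renaming (refl to ≈-refl; sym to ≈-sym; trans to ≈-trans)
  open Exp semiring public using (^-assocʳ)

  strictTotalOrder : StrictTotalOrder c ℓ₁ ℓ₂
  strictTotalOrder = record { isStrictTotalOrder = isStrictTotalOrder }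

  open StrictTotalOrder strictTotalOrder public
    using (compare; irrefl; strictPartialOrder)
    renaming (trans to <-trans)

  private module NonStrict = StrictToNonStrict _≈_ _<_
  module ≤-Reasoning = StrictReasoning strictPartialOrder

  <⇒≤ : ∀ {x y} → x < y → x ≤ y
  <⇒≤ = inj₁

  ≈⇒≤ : ∀ {x y} → x ≈ y → x ≤ y
  ≈⇒≤ = inj₂

  ≤-refl : ∀ {x} → x ≤ x
  ≤-refl = inj₂ ≈-refl

  ≤-trans : ∀ {x y z} → x ≤ y → y ≤ z → x ≤ z
  ≤-trans {x} {y} {z} x≤y y≤z = begin x ≤⟨ x≤y ⟩ y ≤⟨ y≤z ⟩ z ∎
    where open ≤-Reasoning

  <-≤-trans : ∀ {x y z} → x < y → y ≤ z → x < z
  <-≤-trans {x} {y} {z} x<y y≤z = begin-strict x <⟨ x<y ⟩ y ≤⟨ y≤z ⟩ z ∎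
    where open ≤-Reasoning

  ≤-<-trans : ∀ {x y z} → x ≤ y → y < z → x < z
  ≤-<-trans {x} {y} {z} x≤y y<z = begin-strict x ≤⟨ x≤y ⟩ y <⟨ y<z ⟩ z ∎
    where open ≤-Reasoning

  ≤⇒≯ : ∀ {x y} → x ≤ y → ¬ (y < x)
  ≤⇒≯ x≤y y<x = irrefl ≈-refl (≤-<-trans x≤y y<x)

  ≮⇒≥ : ∀ {x y} → ¬ (x < y) → y ≤ x
  ≮⇒≥ {x} {y} x≮y with compare x y
  ... | tri< x<y _ _ = ⊥-elim (x≮y x<y)
  ... | tri≈ _ x≈y _ = inj₂ (≈-sym x≈y)
  ... | tri> _ _ y<x = inj₁ y<x

  infix 4 _<?_ _≤?_

  _<?_ : ∀ x y → Dec (x < y)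
  _<?_ = StrictTotalOrder._<?_ strictTotalOrder

  _≤?_ : ∀ x y → Dec (x ≤ y)
  _≤?_ = NonStrict.decidable′ compare

  +-monoˡ-≤ : ∀ z {x y} → x ≤ y → x + z ≤ y + z
  +-monoˡ-≤ z (inj₁ x<y) = inj₁ (+-monoˡ-< z x<y)
  +-monoˡ-≤ z (inj₂ x≈y) = inj₂ (+-congʳ x≈y)

  +-monoʳ-< : ∀ z {x y} → x < y → z + x < z + y
  +-monoʳ-< z {x} {y} x<y = begin-strict
    z + x ≈⟨ +-comm z x ⟩
    x + z <⟨ +-monoˡ-< z x<y ⟩
    y + z ≈⟨ +-comm y z ⟩
    z + y ∎
    where open ≤-Reasoning

  +-monoʳ-≤ : ∀ z {x y} → x ≤ y → z + x ≤ z + y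
  +-monoʳ-≤ z (inj₁ x<y) = inj₁ (+-monoʳ-< z x<y)
  +-monoʳ-≤ z (inj₂ x≈y) = inj₂ (+-congˡ x≈y)

  +-mono-≤ : ∀ {w x y z} → w ≤ x → y ≤ z → w + y ≤ x + z
  +-mono-≤ {x = x} {y = y} w≤x y≤z = ≤-trans (+-monoˡ-≤ y w≤x) (+-monoʳ-≤ x y≤z)

  +-mono-<-≤ : ∀ {w x y z} → w < x → y ≤ z → w + y < x + z
  +-mono-<-≤ {x = x} {y = y} w<x y≤z = <-≤-trans (+-monoˡ-< y w<x) (+-monoʳ-≤ x y≤z)

  x-y+y≈x : ∀ x y → x - y + y ≈ x
  x-y+y≈x x y = begin-equality
    x - y + y     ≈⟨ +-assoc x (- y) y ⟩
    x + (- y + y) ≈⟨ +-congˡ (-‿inverseˡ y) ⟩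
    x + 0#        ≈⟨ +-identityʳ x ⟩
    x             ∎
    where open ≤-Reasoning

  +-cancelʳ-< : ∀ z {x y} → x + z < y + z → x < y
  +-cancelʳ-< z {x} {y} x+z<y+z with compare x y
  ... | tri< x<y _ _ = x<y
  ... | tri≈ _ x≈y _ = ⊥-elim (irrefl (+-congʳ x≈y) x+z<y+z)
  ... | tri> _ _ y<x = ⊥-elim (≤⇒≯ (inj₁ x+z<y+z) (+-monoˡ-< z y<x))

  +-cancelʳ-≤ : ∀ z {x y} → x + z ≤ y + z → x ≤ y
  +-cancelʳ-≤ z x+z≤y+z = ≮⇒≥ λ y<x → ≤⇒≯ x+z≤y+z (+-monoˡ-< z y<x)

  x<y⇒0<y-x : ∀ {x y} → x < y → 0# < y - x
  x<y⇒0<y-x {x} {y} x<y = +-cancelʳ-< x (begin-strict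
    0# + x    ≈⟨ +-identityˡ x ⟩
    x         <⟨ x<y ⟩
    y         ≈⟨ x-y+y≈x y x ⟨
    y - x + x ∎)
    where open ≤-Reasoning

  *-monoʳ-< : ∀ {x y z} → 0# < z → x < y → x * z < y * z
  *-monoʳ-< {x} {y} {z} 0<z x<y = begin-strict
    x * z               ≈⟨ +-identityˡ (x * z) ⟨
    0# + x * z          <⟨ +-monoˡ-< (x * z) (*-pos (x<y⇒0<y-x x<y) 0<z) ⟩
    (y - x) * z + x * z ≈⟨ distribʳ z (y - x) x ⟨
    (y - x + x) * z     ≈⟨ *-congʳ (x-y+y≈x y x) ⟩
    y * z               ∎
    where open ≤-Reasoning

  *-monoʳ-≤ : ∀ {x y z} → 0# ≤ z → x ≤ y → x * z ≤ y * z
  *-monoʳ-≤ {x} {y} {z} (inj₂ 0≈z) _ = inj₂ (begin-equality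
    x * z  ≈⟨ *-congˡ 0≈z ⟨
    x * 0# ≈⟨ zeroʳ x ⟩
    0#     ≈⟨ zeroʳ y ⟨
    y * 0# ≈⟨ *-congˡ 0≈z ⟩
    y * z  ∎)
    where open ≤-Reasoning
  *-monoʳ-≤ (inj₁ 0<z) (inj₁ x<y) = inj₁ (*-monoʳ-< 0<z x<y)
  *-monoʳ-≤ (inj₁ _)   (inj₂ x≈y) = inj₂ (*-congʳ x≈y)

  *-monoˡ-≤ : ∀ {x y z} → 0# ≤ z → x ≤ y → z * x ≤ z * y
  *-monoˡ-≤ {x} {y} {z} 0≤z x≤y = begin
    z * x ≈⟨ *-comm z x ⟩
    x * z ≤⟨ *-monoʳ-≤ 0≤z x≤y ⟩
    y * z ≈⟨ *-comm y z ⟩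
    z * y ∎
    where open ≤-Reasoning

  *-cancelʳ-≤ : ∀ {x y z} → 0# < z → x * z ≤ y * z → x ≤ y
  *-cancelʳ-≤ 0<z xz≤yz = ≮⇒≥ λ y<x → ≤⇒≯ xz≤yz (*-monoʳ-< 0<z y<x)

  *-cancelʳ-< : ∀ {x y z} → 0# < z → x * z < y * z → x < y
  *-cancelʳ-< {x} {y} 0<z xz<yz with compare x y
  ... | tri< x<y _ _ = x<y
  ... | tri≈ _ x≈y _ = ⊥-elim (irrefl (*-congʳ x≈y) xz<yz)
  ... | tri> _ _ y<x = ⊥-elim (≤⇒≯ (inj₁ xz<yz) (*-monoʳ-< 0<z y<x))

  pos⇒x*x⁻¹≈1 : ∀ {x} → 0# < x → x * x ⁻¹ ≈ 1#
  pos⇒x*x⁻¹≈1 {x} 0<x = ⁻¹-inverseʳ x λ x≈0 → irrefl (≈-sym x≈0) 0<x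

  pos⇒x⁻¹*x≈1 : ∀ {x} → 0# < x → x ⁻¹ * x ≈ 1#
  pos⇒x⁻¹*x≈1 {x} 0<x = ≈-trans (*-comm (x ⁻¹) x) (pos⇒x*x⁻¹≈1 0<x)

  ⁻¹-pos : ∀ {x} → 0# < x → 0# < x ⁻¹
  ⁻¹-pos {x} 0<x = *-cancelʳ-< 0<x (begin-strict
    0# * x   ≈⟨ zeroˡ x ⟩
    0#       <⟨ 0<1 ⟩
    1#       ≈⟨ pos⇒x⁻¹*x≈1 0<x ⟨
    x ⁻¹ * x ∎)
    where open ≤-Reasoning

  fromℕ-+ : ∀ m n → fromℕ (m ℕ.+ n) ≈ fromℕ m + fromℕ n
  fromℕ-+ m n = Mult.×-homo-+ semiring 1# m n

  fromℕ-* : ∀ m n → fromℕ (m ℕ.* n) ≈ fromℕ m * fromℕ n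
  fromℕ-* = Mult.×1-homo-* semiring

  fromℕ-1 : fromℕ 1 ≈ 1#
  fromℕ-1 = +-identityʳ 1#

  fromℕ-nonneg : ∀ m → 0# ≤ fromℕ m
  fromℕ-nonneg zero    = ≤-refl
  fromℕ-nonneg (suc m) = begin
    0#           ≈⟨ +-identityʳ 0# ⟨
    0# + 0#      ≤⟨ +-mono-≤ (<⇒≤ 0<1) (fromℕ-nonneg m) ⟩
    1# + fromℕ m ∎
    where open ≤-Reasoning

  fromℕ-mono-≤ : ∀ {m n} → m ℕ.≤ n → fromℕ m ≤ fromℕ n
  fromℕ-mono-≤ {n = n} z≤n = fromℕ-nonneg n
  fromℕ-mono-≤ (s≤s m≤n)   = +-monoʳ-≤ 1# (fromℕ-mono-≤ m≤n)

  fromℕ-mono-< : ∀ {m n} → m ℕ.< n → fromℕ m < fromℕ n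
  fromℕ-mono-< {m} {n} m<n = begin-strict
    fromℕ m      ≈⟨ +-identityˡ (fromℕ m) ⟨
    0# + fromℕ m <⟨ +-monoˡ-< (fromℕ m) 0<1 ⟩
    1# + fromℕ m ≤⟨ fromℕ-mono-≤ m<n ⟩
    fromℕ n      ∎
    where open ≤-Reasoning

  fromℕ-pos : ∀ {m} → 1 ℕ.≤ m → 0# < fromℕ m
  fromℕ-pos = fromℕ-mono-<

  fromℕ-cancel-≤ : ∀ {m n} → fromℕ m ≤ fromℕ n → m ℕ.≤ n
  fromℕ-cancel-≤ m≤n = ℕ.≮⇒≥ λ n<m → ≤⇒≯ m≤n (fromℕ-mono-< n<m)

  ^-pos : ∀ {x} → 0# < x → ∀ m → 0# < x ^ m
  ^-pos 0<x zero    = 0<1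
  ^-pos 0<x (suc m) = *-pos 0<x (^-pos 0<x m)

  ^-monoˡ-≤ : ∀ {x y} → 0# < x → x ≤ y → ∀ m → x ^ m ≤ y ^ m
  ^-monoˡ-≤ 0<x x≤y zero    = ≤-refl
  ^-monoˡ-≤ {x} {y} 0<x x≤y (suc m) = begin
    x * x ^ m ≤⟨ *-monoʳ-≤ (<⇒≤ (^-pos 0<x m)) x≤y ⟩
    y * x ^ m ≤⟨ *-monoˡ-≤ (<⇒≤ (<-≤-trans 0<x x≤y)) (^-monoˡ-≤ 0<x x≤y m) ⟩
    y * y ^ m ∎
    where open ≤-Reasoning

  1≤x⇒1≤x^m : ∀ {x} → 1# ≤ x → ∀ m → 1# ≤ x ^ m
  1≤x⇒1≤x^m 1≤x zero    = ≤-refl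
  1≤x⇒1≤x^m {x} 1≤x (suc m) = begin
    1#        ≤⟨ 1≤x⇒1≤x^m 1≤x m ⟩
    x ^ m     ≈⟨ *-identityˡ (x ^ m) ⟨
    1# * x ^ m ≤⟨ *-monoʳ-≤ (<⇒≤ (^-pos (<-≤-trans 0<1 1≤x) m)) 1≤x ⟩
    x * x ^ m ∎
    where open ≤-Reasoning

  ^-monoʳ-≤ : ∀ {x} → 1# ≤ x → ∀ {m n} → m ℕ.≤ n → x ^ m ≤ x ^ n
  ^-monoʳ-≤ 1≤x {n = n} z≤n = 1≤x⇒1≤x^m 1≤x n
  ^-monoʳ-≤ 1≤x (s≤s m≤n)   =
    *-monoˡ-≤ (<⇒≤ (<-≤-trans 0<1 1≤x)) (^-monoʳ-≤ 1≤x m≤n)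

  x+x≈fromℕ2*x : ∀ x → x + x ≈ fromℕ 2 * x
  x+x≈fromℕ2*x x = begin-equality
    x + x           ≈⟨ +-cong (*-identityˡ x) (*-identityˡ x) ⟨
    1# * x + 1# * x ≈⟨ distribʳ x 1# 1# ⟨
    (1# + 1#) * x   ≈⟨ *-congʳ (+-congˡ fromℕ-1) ⟨
    fromℕ 2 * x     ∎
    where open ≤-Reasoning

  ½+½≈1 : ½ + ½ ≈ 1#
  ½+½≈1 = ≈-trans (x+x≈fromℕ2*x ½) (pos⇒x*x⁻¹≈1 (fromℕ-pos {2} (s≤s z≤n)))

  -- Integer logarithms to a base at least 2

  module Logarithm {b : Carrier} (2≤b : fromℕ 2 ≤ b) where

    1<b : 1# < b
    1<b = begin-strict
      1#      ≈⟨ fromℕ-1 ⟨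
      fromℕ 1 <⟨ fromℕ-mono-< {1} {2} (s≤s (s≤s z≤n)) ⟩
      fromℕ 2 ≤⟨ 2≤b ⟩
      b       ∎
      where open ≤-Reasoning

    1≤b : 1# ≤ b
    1≤b = <⇒≤ 1<b

    0<b : 0# < b
    0<b = <-trans 0<1 1<b

    -- Each step adds 1 on the left and at least doubles the right. This bounds the search for a
    -- least exponent, so integer logarithms exist without the Archimedean property.
    n<b^n : ∀ n → fromℕ n < b ^ n
    n<b^n zero    = 0<1
    n<b^n (suc n) = begin-strict
      1# + fromℕ n    ≈⟨ +-comm 1# (fromℕ n) ⟩
      fromℕ n + 1#    <⟨ +-mono-<-≤ (n<b^n n) (1≤x⇒1≤x^m 1≤b n) ⟩
      b ^ n + b ^ n   ≈⟨ x+x≈fromℕ2*x (b ^ n) ⟩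
      fromℕ 2 * b ^ n ≤⟨ *-monoʳ-≤ (<⇒≤ (^-pos (<-≤-trans 0<1 1≤b) n)) 2≤b ⟩
      b * b ^ n       ∎
      where open ≤-Reasoning

    -- level s = 1 + ⌊log_b s⌋ for s > 0, and level 0 = 0.
    private
      leastLevel : ∀ s → ∃[ t ] fromℕ s < b ^ t × (∀ t′ → fromℕ s < b ^ t′ → t ℕ.≤ t′)
      leastLevel s = least (λ t → fromℕ s <? b ^ t) {s} (n<b^n s)

    level : ℕ → ℕ
    level s = proj₁ (leastLevel s)

    level-upper : ∀ s → fromℕ s < b ^ level s
    level-upper s = proj₁ (proj₂ (leastLevel s))

    level-least : ∀ s t → fromℕ s < b ^ t → level s ℕ.≤ t
    level-least s = proj₂ (proj₂ (leastLevel s))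

    level-mono-≤ : ∀ {s t} → s ℕ.≤ t → level s ℕ.≤ level t
    level-mono-≤ {s} {t} s≤t =
      level-least s (level t) (≤-<-trans (fromℕ-mono-≤ s≤t) (level-upper t))

    level-lower : ∀ s t → suc t ℕ.≤ level s → b ^ t ≤ fromℕ s
    level-lower s t t<l = ≮⇒≥ λ s<b^t → ℕ.<⇒≱ t<l (level-least s t s<b^t)

    -- Dividing a size by `b` costs one level. The case `s = 0` is included: `level` uses a strict
    -- inequality, so `level 0 = 0` while `level t` is positive for `t ≥ 1`. A cluster that is
    -- absorbed whole therefore loses weight as well.
    b*s≤t⇒level-< : ∀ s t → 1 ℕ.≤ t → b * fromℕ s ≤ fromℕ t → level s ℕ.< level t
    b*s≤t⇒level-< s t 1≤t bs≤t with level t | level-upper t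
    ... | zero  | t<1 = ⊥-elim (≤⇒≯ (≤-trans (≈⇒≤ (≈-sym fromℕ-1)) (fromℕ-mono-≤ 1≤t)) t<1)
    ... | suc l | t<b^1+l = s≤s (level-least s l (*-cancelʳ-< 0<b (begin-strict
      fromℕ s * b ≈⟨ *-comm (fromℕ s) b ⟩
      b * fromℕ s ≤⟨ bs≤t ⟩
      fromℕ t     <⟨ t<b^1+l ⟩
      b * b ^ l   ≈⟨ *-comm b (b ^ l) ⟩
      b ^ l * b   ∎)))
      where open ≤-Reasoning

    ⌈log⌉ : ∀ n → ∃[ L ] (L ≡⌈log[ b ] n ⌉)
    ⌈log⌉ n = least (λ t → fromℕ n ≤? b ^ t) {n} (<⇒≤ (n<b^n n))

    -- From `n ≤ b ^ L < b ^ (L + 1)` the level is at most `L + 1`, and `L + 1 ≤ 2 L` once `L` is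
    -- positive; `2 ≤ n` excludes `L = 0`.
    level≤2*⌈log⌉ : ∀ {n} L → 2 ℕ.≤ n → L ≡⌈log[ b ] n ⌉ → level n ℕ.≤ 2 ℕ.* L
    level≤2*⌈log⌉ zero 2≤n (n≤1 , _) = ⊥-elim (≤⇒≯ n≤1 (<-≤-trans
      (≤-<-trans (≈⇒≤ (≈-sym fromℕ-1)) (fromℕ-mono-< {1} {2} (s≤s (s≤s z≤n)))) (fromℕ-mono-≤ 2≤n)))
    level≤2*⌈log⌉ {n} L@(suc l) _ (n≤b^L , _) = ℕ.≤-trans
      (level-least n (suc L) (begin-strict
        fromℕ n    ≤⟨ n≤b^L ⟩
        b ^ L      ≈⟨ *-identityˡ (b ^ L) ⟨
        1# * b ^ L <⟨ *-monoʳ-< (^-pos 0<b L) 1<b ⟩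
        b * b ^ L  ∎))
      (ℕ.≤-trans (ℕ.+-monoˡ-≤ L {1} {L} (s≤s z≤n)) (ℕ.≤-reflexive (cong (L ℕ.+_) (sym (ℕ.+-identityʳ L)))))
      where open ≤-Reasoning

    -- This is `1 + ⌊log_b n⌋ ≤ 2 log_b n` with both sides exponentiated. If the floor is at least
    -- 1, adding 1 at most doubles it; if it is 0, the inequality is the hypothesis itself.
    b^level≤n² : ∀ {n} → 1 ≤ 2 ·log[ b ] n → b ^ level n ≤ fromℕ n ^ 2
    b^level≤n² {n} b≤n² with level n in eq
    ... | zero        = ≤-trans 1≤b (≤-trans (≈⇒≤ (≈-sym (*-identityʳ b))) b≤n²)
    ... | suc zero    = b≤n²
    ... | suc (suc f) = begin
      b ^ (2 ℕ.+ f)         ≤⟨ ^-monoʳ-≤ 1≤b {2 ℕ.+ f} {suc f ℕ.* 2} (ℕ.+-monoʳ-≤ 2 (ℕ.m≤m*n f 2)) ⟩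
      b ^ (suc f ℕ.* 2)     ≈⟨ ^-assocʳ b (suc f) 2 ⟨
      (b ^ suc f) ^ 2       ≤⟨ ^-monoˡ-≤ (^-pos 0<b (suc f)) (level-lower n (suc f) (ℕ.≤-reflexive (sym eq))) 2 ⟩
      fromℕ n ^ 2           ∎
      where open ≤-Reasoning

    m≤M*level⇒m≤2M·log : ∀ {m n} M → m ℕ.≤ M ℕ.* level n → 1 ≤ 2 ·log[ b ] n → m ≤ 2 ℕ.* M ·log[ b ] n
    m≤M*level⇒m≤2M·log {m} {n} M m≤ b≤n² = begin
      b ^ m                  ≤⟨ ^-monoʳ-≤ 1≤b (ℕ.≤-trans m≤ (ℕ.≤-reflexive (ℕ.*-comm M (level n)))) ⟩
      b ^ (level n ℕ.* M)    ≈⟨ ^-assocʳ b (level n) M ⟨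
      (b ^ level n) ^ M      ≤⟨ ^-monoˡ-≤ (^-pos 0<b (level n)) (b^level≤n² {n} b≤n²) M ⟩
      (fromℕ n ^ 2) ^ M      ≈⟨ ^-assocʳ (fromℕ n) 2 M ⟩
      fromℕ n ^ (2 ℕ.* M)    ∎
      where open ≤-Reasoning

    m≤M*level⇒m≤2M*⌈log⌉ : ∀ {m n} M L → m ≡ 0 ⊎ 2 ℕ.≤ n → L ≡⌈log[ b ] n ⌉ →
                           m ℕ.≤ M ℕ.* level n → m ℕ.≤ 2 ℕ.* M ℕ.* L
    m≤M*level⇒m≤2M*⌈log⌉ M L (inj₁ refl) _ _ = z≤n
    m≤M*level⇒m≤2M*⌈log⌉ {m} {n} M L (inj₂ 2≤n) isLog m≤ = begin
      m                ≤⟨ m≤ ⟩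
      M ℕ.* level n    ≤⟨ ℕ.*-monoʳ-≤ M (level≤2*⌈log⌉ L 2≤n isLog) ⟩
      M ℕ.* (2 ℕ.* L)  ≡⟨ ℕ.*-assoc M 2 L ⟨
      M ℕ.* 2 ℕ.* L    ≡⟨ cong (ℕ._* L) (ℕ.*-comm M 2) ⟩
      2 ℕ.* M ℕ.* L    ∎
      where open ℕ.≤-Reasoning

  -- Consequences of η > 1/2 for the base 1/(1 - η)

  module MergeRatio {η : Carrier} (½<η : ½ < η) (η<1 : η < 1#) where

    0<½ : 0# < ½
    0<½ = ⁻¹-pos (fromℕ-pos {2} (s≤s z≤n))

    0<η : 0# < η
    0<η = <-trans 0<½ ½<η

    0<1-η : 0# < 1# - η
    0<1-η = x<y⇒0<y-x η<1

    1-η≤½ : 1# - η ≤ ½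
    1-η≤½ = +-cancelʳ-≤ η (begin
      1# - η + η ≈⟨ x-y+y≈x 1# η ⟩
      1#         ≈⟨ ½+½≈1 ⟨
      ½ + ½      ≤⟨ +-monoʳ-≤ ½ (<⇒≤ ½<η) ⟩
      ½ + η      ∎)
      where open ≤-Reasoning

    2≤b : fromℕ 2 ≤ (1# - η) ⁻¹
    2≤b = *-cancelʳ-≤ 0<1-η (begin
      fromℕ 2 * (1# - η)      ≤⟨ *-monoˡ-≤ (fromℕ-nonneg 2) 1-η≤½ ⟩
      fromℕ 2 * ½             ≈⟨ pos⇒x*x⁻¹≈1 (fromℕ-pos {2} (s≤s z≤n)) ⟩
      1#                      ≈⟨ pos⇒x⁻¹*x≈1 0<1-η ⟨
      (1# - η) ⁻¹ * (1# - η)  ∎)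
      where open ≤-Reasoning

    -- With at least `η s` elements removed, at most `(1 - η) s` are left, and the factor `b`
    -- cancels `1 - η`.
    b*rest≤ : ∀ {r s t} → r ℕ.+ t ≡ s → η * fromℕ s ≤ fromℕ r → (1# - η) ⁻¹ * fromℕ t ≤ fromℕ s
    b*rest≤ {r} {s} {t} refl ηs≤r = begin
      b * fromℕ t               ≤⟨ *-monoˡ-≤ (<⇒≤ (⁻¹-pos 0<1-η)) t≤ ⟩
      b * ((1# - η) * fromℕ s)  ≈⟨ *-assoc b (1# - η) (fromℕ s) ⟨
      b * (1# - η) * fromℕ s    ≈⟨ *-congʳ (pos⇒x⁻¹*x≈1 0<1-η) ⟩
      1# * fromℕ s              ≈⟨ *-identityˡ (fromℕ s) ⟩
      fromℕ s                   ∎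
      where
      open ≤-Reasoning
      b = (1# - η) ⁻¹
      t≤ : fromℕ t ≤ (1# - η) * fromℕ s
      t≤ = +-cancelʳ-≤ (η * fromℕ s) (begin
        fromℕ t + η * fromℕ s              ≤⟨ +-monoʳ-≤ (fromℕ t) ηs≤r ⟩
        fromℕ t + fromℕ r                  ≈⟨ +-comm (fromℕ t) (fromℕ r) ⟩
        fromℕ r + fromℕ t                  ≈⟨ fromℕ-+ r t ⟨
        fromℕ s                            ≈⟨ *-identityˡ (fromℕ s) ⟨
        1# * fromℕ s                       ≈⟨ *-congʳ (x-y+y≈x 1# η) ⟨
        (1# - η + η) * fromℕ s             ≈⟨ distribʳ (fromℕ s) (1# - η) η ⟩
        (1# - η) * fromℕ s + η * fromℕ s   ∎)

    -- Holds because `η + η > 1`; it forbids two disjoint sets from both holding an `η`-fraction of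
    -- one cluster.
    two-majorities : ∀ {r₁ r₂ s} → 1 ℕ.≤ s →
                     η * fromℕ s ≤ fromℕ r₁ → η * fromℕ s ≤ fromℕ r₂ → s ℕ.< r₁ ℕ.+ r₂
    two-majorities {r₁} {r₂} {s} 1≤s ηs≤r₁ ηs≤r₂ = ℕ.≰⇒> λ r≤s → ≤⇒≯ (fromℕ-mono-≤ r≤s) (begin-strict
      fromℕ s                   ≈⟨ *-identityˡ (fromℕ s) ⟨
      1# * fromℕ s              ≈⟨ *-congʳ ½+½≈1 ⟨
      (½ + ½) * fromℕ s         <⟨ *-monoʳ-< (fromℕ-pos 1≤s) (+-mono-<-≤ ½<η (<⇒≤ ½<η)) ⟩
      (η + η) * fromℕ s         ≈⟨ distribʳ (fromℕ s) η η ⟩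
      η * fromℕ s + η * fromℕ s ≤⟨ +-mono-≤ ηs≤r₁ ηs≤r₂ ⟩
      fromℕ r₁ + fromℕ r₂       ≈⟨ fromℕ-+ r₁ r₂ ⟨
      fromℕ (r₁ ℕ.+ r₂)         ∎)
      where open ≤-Reasoning

-- Finite sets and counting

private variable
  n : ℕ

Disjoint : Rel (Subset n) _
Disjoint A B = Empty (A ∩ B)

Disjoint-sym : SymmetricRel (Disjoint {n})
Disjoint-sym {x = A} {y = B} A∩B=∅ (x , x∈B∩A) with x∈p∩q⁻ B A x∈B∩A
... | x∈B , x∈A = A∩B=∅ (x , x∈p∩q⁺ (x∈A , x∈B))

disjoint⇒∉ : ∀ {A B : Subset n} {x} → Disjoint A B → x ∈ˢ A → x ∉ˢ B
disjoint⇒∉ {x = x} A∩B=∅ x∈A x∈B = A∩B=∅ (x , x∈p∩q⁺ (x∈A , x∈B))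

∉⇒disjoint : ∀ {A B : Subset n} → (∀ {x} → x ∈ˢ A → x ∉ˢ B) → Disjoint A B
∉⇒disjoint {A = A} {B} A∌B (x , x∈A∩B) with x∈p∩q⁻ A B x∈A∩B
... | x∈A , x∈B = A∌B x∈A x∈B

x∈p─q⇒x∉q : ∀ (p q : Subset n) {x} → x ∈ˢ p ─ q → x ∉ˢ q
x∈p─q⇒x∉q (s ∷ p) (outside ∷ q) {zero}  _           ()
x∈p─q⇒x∉q (s ∷ p) (inside  ∷ q) {zero}  ()
x∈p─q⇒x∉q (s ∷ p) (t ∷ q)       {suc x} (there x∈) (there x∈q) = x∈p─q⇒x∉q p q x∈ x∈q

∪-⊆ : ∀ {A B D : Subset n} → A ⊆ D → B ⊆ D → A ∪ B ⊆ D
∪-⊆ {A = A} {B} A⊆D B⊆D x∈ with x∈p∪q⁻ A B x∈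
... | inj₁ x∈A = A⊆D x∈A
... | inj₂ x∈B = B⊆D x∈B

∪-disjoint : ∀ {A B D : Subset n} → Disjoint A D → Disjoint B D → Disjoint (A ∪ B) D
∪-disjoint {A = A} {B} A∩D=∅ B∩D=∅ = ∉⇒disjoint λ x∈ x∈D → case (x∈p∪q⁻ A B x∈) of λ where
  (inj₁ x∈A) → disjoint⇒∉ A∩D=∅ x∈A x∈D
  (inj₂ x∈B) → disjoint⇒∉ B∩D=∅ x∈B x∈D

⊆∪-disjointˡ : ∀ {A B D : Subset n} → A ⊆ B ∪ D → Disjoint A B → A ⊆ D
⊆∪-disjointˡ {B = B} {D} A⊆B∪D A∩B=∅ x∈A with x∈p∪q⁻ B D (A⊆B∪D x∈A)
... | inj₁ x∈B = ⊥-elim (disjoint⇒∉ A∩B=∅ x∈A x∈B)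
... | inj₂ x∈D = x∈D

⊆∪-disjointʳ : ∀ {A B D : Subset n} → A ⊆ B ∪ D → Disjoint A D → A ⊆ B
⊆∪-disjointʳ {B = B} {D} A⊆B∪D A∩D=∅ x∈A with x∈p∪q⁻ B D (A⊆B∪D x∈A)
... | inj₁ x∈B = x∈B
... | inj₂ x∈D = ⊥-elim (disjoint⇒∉ A∩D=∅ x∈A x∈D)

─-empty⇒⊆ : ∀ {A B : Subset n} → Empty (A ─ B) → A ⊆ B
─-empty⇒⊆ {B = B} A─B=∅ {x} x∈A with x ∈? B
... | yes x∈B = x∈B
... | no  x∉B = ⊥-elim (A─B=∅ (x , x∈p∧x∉q⇒x∈p─q x∈A x∉B))

∣p∩q∣+∣p─q∣≡∣p∣ : ∀ (p q : Subset n) → ∣ p ∩ q ∣ ℕ.+ ∣ p ─ q ∣ ≡ ∣ p ∣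
∣p∩q∣+∣p─q∣≡∣p∣ []            []            = refl
∣p∩q∣+∣p─q∣≡∣p∣ (inside  ∷ p) (inside  ∷ q) = cong suc (∣p∩q∣+∣p─q∣≡∣p∣ p q)
∣p∩q∣+∣p─q∣≡∣p∣ (inside  ∷ p) (outside ∷ q) =
  trans (ℕ.+-suc ∣ p ∩ q ∣ ∣ p ─ q ∣) (cong suc (∣p∩q∣+∣p─q∣≡∣p∣ p q))
∣p∩q∣+∣p─q∣≡∣p∣ (outside ∷ p) (inside  ∷ q) = ∣p∩q∣+∣p─q∣≡∣p∣ p q
∣p∩q∣+∣p─q∣≡∣p∣ (outside ∷ p) (outside ∷ q) = ∣p∩q∣+∣p─q∣≡∣p∣ p q

nonempty⇒1≤∣p∣ : ∀ {p : Subset n} → Nonempty p → 1 ℕ.≤ ∣ p ∣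
nonempty⇒1≤∣p∣ (x , x∈p) = ℕ.≤-trans (s≤s z≤n) (x∈p⇒∣p-x∣<∣p∣ x∈p)

1≤∣p∣⇒nonempty : ∀ (p : Subset n) → 1 ℕ.≤ ∣ p ∣ → Nonempty p
1≤∣p∣⇒nonempty {n} p 1≤∣p∣ with nonempty? p
... | yes p≠∅ = p≠∅
... | no  p=∅ = ⊥-elim (ℕ.<⇒≱ 1≤∣p∣ (ℕ.≤-reflexive (trans (cong ∣_∣ (Empty-unique p=∅)) (∣⊥∣≡0 n))))

∣p∣≤∣q∩p∣⇒p⊆q : ∀ (p q : Subset n) → ∣ p ∣ ℕ.≤ ∣ q ∩ p ∣ → p ⊆ q
∣p∣≤∣q∩p∣⇒p⊆q p q ∣p∣≤ {x} x∈p with x ∈? q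
... | yes x∈q = x∈q
... | no  x∉q = ⊥-elim (ℕ.<⇒≱ (ℕ.m<m+n ∣ p ∩ q ∣ (nonempty⇒1≤∣p∣ (x , x∈p∧x∉q⇒x∈p─q x∈p x∉q)))
  (ℕ.≤-trans (ℕ.≤-reflexive (∣p∩q∣+∣p─q∣≡∣p∣ p q))
    (subst (λ r → ∣ p ∣ ℕ.≤ ∣ r ∣) (∩-comm q p) ∣p∣≤)))

p⊆q⇒q∩p≡p : ∀ (p q : Subset n) → p ⊆ q → q ∩ p ≡ p
p⊆q⇒q∩p≡p p q p⊆q = ⊆-antisym (p∩q⊆q q p) λ x∈p → x∈p∩q⁺ (p⊆q x∈p , x∈p)

disjoint⇒∣p∩r∣+∣q∩r∣≤∣r∣ : ∀ (p q r : Subset n) → Disjoint p q → ∣ p ∩ r ∣ ℕ.+ ∣ q ∩ r ∣ ℕ.≤ ∣ r ∣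
disjoint⇒∣p∩r∣+∣q∩r∣≤∣r∣ p q r p∩q=∅ = begin
  ∣ p ∩ r ∣ ℕ.+ ∣ q ∩ r ∣ ≤⟨ ℕ.+-mono-≤ (ℕ.≤-reflexive (cong ∣_∣ (∩-comm p r))) (p⊆q⇒∣p∣≤∣q∣ q∩r⊆r─p) ⟩
  ∣ r ∩ p ∣ ℕ.+ ∣ r ─ p ∣ ≡⟨ ∣p∩q∣+∣p─q∣≡∣p∣ r p ⟩
  ∣ r ∣                   ∎
  where
  open ℕ.≤-Reasoning
  q∩r⊆r─p : q ∩ r ⊆ r ─ p
  q∩r⊆r─p x∈ with x∈p∩q⁻ q r x∈
  ... | x∈q , x∈r = x∈p∧x∉q⇒x∈p─q x∈r λ x∈p → disjoint⇒∉ p∩q=∅ x∈p x∈q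

module _ {a} {A : Set a} where

  AllPairs-lookup : ∀ {ℓ} {R : Rel A ℓ} → SymmetricRel R → ∀ {xs x y} → AllPairs R xs →
                    x ∈ xs → y ∈ xs → x ≡ y ⊎ R x y
  AllPairs-lookup sym (rs ∷ _)  (here refl) (here refl) = inj₁ refl
  AllPairs-lookup sym (rs ∷ _)  (here refl) (there y∈)  = inj₂ (All.lookup rs y∈)
  AllPairs-lookup sym (rs ∷ _)  (there x∈)  (here refl) = inj₂ (sym (All.lookup rs x∈))
  AllPairs-lookup sym (_ ∷ rss) (there x∈)  (there y∈)  = AllPairs-lookup sym rss x∈ y∈

  AllPairs-resp-↭ : ∀ {ℓ} {R : Rel A ℓ} → SymmetricRel R → ∀ {xs ys} → xs ↭ ys → AllPairs R xs → AllPairs R ys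
  AllPairs-resp-↭ {R = R} sym xs↭ys = ↭ₛ.AllPairs-resp-↭ (setoid A) sym (resp₂ R) (↭⇒↭ₛ xs↭ys)

  ∈⇒↭∷ : ∀ {x : A} {xs} → x ∈ xs → ∃[ rest ] xs ↭ x ∷ rest
  ∈⇒↭∷ x∈xs with ∈-∃++ x∈xs
  ... | ys , zs , refl = ys ++ zs , shift _ ys zs

  ∈⇒↭∷∷ : ∀ {x y : A} {xs} → x ∈ xs → y ∈ xs → x ≢ y → ∃[ rest ] xs ↭ x ∷ y ∷ rest
  ∈⇒↭∷∷ x∈xs y∈xs x≢y with ∈⇒↭∷ x∈xs
  ... | ys , xs↭ with ∈-resp-↭ xs↭ y∈xs
  ...   | here y≡x = ⊥-elim (x≢y (sym y≡x))
  ...   | there y∈ys with ∈⇒↭∷ y∈ys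
  ...     | zs , ys↭ = zs , ↭-trans xs↭ (↭-prep _ ys↭)

  Σ : (A → ℕ) → List A → ℕ
  Σ f xs = sum (map f xs)

  Σ-mono : ∀ {f g : A → ℕ} xs → (∀ {x} → x ∈ xs → f x ℕ.≤ g x) → Σ f xs ℕ.≤ Σ g xs
  Σ-mono []       f≤g = z≤n
  Σ-mono (x ∷ xs) f≤g = ℕ.+-mono-≤ (f≤g (here refl)) (Σ-mono xs λ x∈ → f≤g (there x∈))

  Σ-+ : ∀ (f g : A → ℕ) xs → Σ (λ x → f x ℕ.+ g x) xs ≡ Σ f xs ℕ.+ Σ g xs
  Σ-+ f g []       = refl
  Σ-+ f g (x ∷ xs) = begin
    (f x ℕ.+ g x) ℕ.+ Σ (λ y → f y ℕ.+ g y) xs ≡⟨ cong ((f x ℕ.+ g x) ℕ.+_) (Σ-+ f g xs) ⟩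
    (f x ℕ.+ g x) ℕ.+ (Σ f xs ℕ.+ Σ g xs)      ≡⟨ ℕ.+-assoc (f x) (g x) _ ⟩
    f x ℕ.+ (g x ℕ.+ (Σ f xs ℕ.+ Σ g xs))      ≡⟨ cong (f x ℕ.+_) (ℕ.+-assoc (g x) (Σ f xs) (Σ g xs)) ⟨
    f x ℕ.+ (g x ℕ.+ Σ f xs ℕ.+ Σ g xs)        ≡⟨ cong (λ m → f x ℕ.+ (m ℕ.+ Σ g xs)) (ℕ.+-comm (g x) (Σ f xs)) ⟩
    f x ℕ.+ (Σ f xs ℕ.+ g x ℕ.+ Σ g xs)        ≡⟨ cong (f x ℕ.+_) (ℕ.+-assoc (Σ f xs) (g x) (Σ g xs)) ⟩
    f x ℕ.+ (Σ f xs ℕ.+ (g x ℕ.+ Σ g xs))      ≡⟨ ℕ.+-assoc (f x) (Σ f xs) _ ⟨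
    (f x ℕ.+ Σ f xs) ℕ.+ (g x ℕ.+ Σ g xs)      ∎
    where open ≡-Reasoning

  Σ-*ʳ : ∀ (f : A → ℕ) k xs → Σ (λ x → f x ℕ.* k) xs ≡ Σ f xs ℕ.* k
  Σ-*ʳ f k []       = refl
  Σ-*ʳ f k (x ∷ xs) = trans (cong (f x ℕ.* k ℕ.+_) (Σ-*ʳ f k xs)) (sym (ℕ.*-distribʳ-+ k (f x) (Σ f xs)))

  Σ-1 : ∀ (xs : List A) → Σ (λ _ → 1) xs ≡ length xs
  Σ-1 []       = refl
  Σ-1 (x ∷ xs) = cong suc (Σ-1 xs)

  Σ-0 : ∀ {f : A → ℕ} xs → (∀ {x} → x ∈ xs → f x ≡ 0) → Σ f xs ≡ 0
  Σ-0 []       f≡0 = refl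
  Σ-0 (x ∷ xs) f≡0 = cong₂ ℕ._+_ (f≡0 (here refl)) (Σ-0 xs λ x∈ → f≡0 (there x∈))

  Σ-∈ : ∀ (f : A → ℕ) {x xs} → x ∈ xs → f x ℕ.≤ Σ f xs
  Σ-∈ f (here refl) = ℕ.m≤m+n (f _) _
  Σ-∈ f (there x∈)  = ℕ.≤-trans (Σ-∈ f x∈) (ℕ.m≤n+m _ _)

  Σ-filter : ∀ {p} {P : Pred A p} (P? : Decidable P) (f : A → ℕ) xs → Σ f (filter P? xs) ℕ.≤ Σ f xs
  Σ-filter P? f []       = z≤n
  Σ-filter P? f (x ∷ xs) with P? x
  ... | yes _ = ℕ.+-monoʳ-≤ (f x) (Σ-filter P? f xs)
  ... | no  _ = ℕ.≤-trans (Σ-filter P? f xs) (ℕ.m≤n+m _ _)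

-- Counting the clusters that a set meets

meets : Subset n → Subset n → ℕ
meets A B with nonempty? (B ∩ A)
... | yes _ = 1
... | no  _ = 0

meets-yes : ∀ {A B : Subset n} → Nonempty (B ∩ A) → meets A B ≡ 1
meets-yes {A = A} {B} B∩A≠∅ with nonempty? (B ∩ A)
... | yes _     = refl
... | no  B∩A=∅ = ⊥-elim (B∩A=∅ B∩A≠∅)

meets-no : ∀ {A B : Subset n} → Disjoint B A → meets A B ≡ 0
meets-no {A = A} {B} B∩A=∅ with nonempty? (B ∩ A)
... | yes B∩A≠∅ = ⊥-elim (B∩A=∅ B∩A≠∅)
... | no  _     = refl

meets-sym : ∀ (A B : Subset n) → meets A B ≡ meets B A
meets-sym A B with nonempty? (B ∩ A)
... | yes B∩A≠∅ = sym (meets-yes (subst Nonempty (∩-comm B A) B∩A≠∅))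
... | no  B∩A=∅ = sym (meets-no (Disjoint-sym B∩A=∅))

meets-mono : ∀ {A B : Subset n} q → A ⊆ B → meets A q ℕ.≤ meets B q
meets-mono {A = A} {B} q A⊆B with nonempty? (q ∩ A)
... | no _ = z≤n
... | yes (x , x∈) with x∈p∩q⁻ q A x∈
...   | x∈q , x∈A rewrite meets-yes {A = B} {q} (x , x∈p∩q⁺ (x∈q , A⊆B x∈A)) = s≤s z≤n

-- Spelled like the count inside `dist`, so that `dist C C′` unfolds to a sum of
-- `cells (clusters C′) A ∸ 1`.
cells : List (Subset n) → Subset n → ℕ
cells Q A = length (filter (λ B → nonempty? (B ∩ A)) Q)

cells≡Σ : ∀ (Q : List (Subset n)) A → cells Q A ≡ Σ (meets A) Q
cells≡Σ []      A = refl
cells≡Σ (B ∷ Q) A with nonempty? (B ∩ A)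
... | yes _ = cong suc (cells≡Σ Q A)
... | no  _ = cells≡Σ Q A

-- Double counting of the meeting pairs: writing the counts as sums of 0-1 values lets the order of
-- summation be exchanged.
Σ-meets-swap : ∀ (P Q : List (Subset n)) → Σ (λ A → Σ (meets A) Q) P ≡ Σ (λ B → Σ (meets B) P) Q
Σ-meets-swap []      Q = sym (Σ-0 Q λ _ → refl)
Σ-meets-swap (A ∷ P) Q = begin
  Σ (meets A) Q ℕ.+ Σ (λ A′ → Σ (meets A′) Q) P      ≡⟨ cong₂ ℕ._+_ (Σ-cong Q) (Σ-meets-swap P Q) ⟩
  Σ (λ B → meets B A) Q ℕ.+ Σ (λ B → Σ (meets B) P) Q ≡⟨ Σ-+ (λ B → meets B A) (λ B → Σ (meets B) P) Q ⟨
  Σ (λ B → Σ (meets B) (A ∷ P)) Q                     ∎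
  where
  open ≡-Reasoning
  Σ-cong : ∀ Q → Σ (meets A) Q ≡ Σ (λ B → meets B A) Q
  Σ-cong []      = refl
  Σ-cong (B ∷ Q) = cong₂ ℕ._+_ (meets-sym A B) (Σ-cong Q)

module _ {Q : List (Subset n)} where

  cells-mono : ∀ {A B} → A ⊆ B → cells Q A ℕ.≤ cells Q B
  cells-mono {A} {B} A⊆B rewrite cells≡Σ Q A | cells≡Σ Q B = Σ-mono Q λ {q} _ → meets-mono q A⊆B

  -- No member of `Q` is counted for both `A₁` and `A₂`. This is the form in which a split benefits
  -- from laminarity.
  cells-separated : ∀ {A A₁ A₂} → A₁ ⊆ A → A₂ ⊆ A →
                    (∀ {q} → q ∈ Q → Disjoint q A₁ ⊎ Disjoint q A₂) →
                    cells Q A₁ ℕ.+ cells Q A₂ ℕ.≤ cells Q A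
  cells-separated {A} {A₁} {A₂} A₁⊆A A₂⊆A separated
    rewrite cells≡Σ Q A | cells≡Σ Q A₁ | cells≡Σ Q A₂ | sym (Σ-+ (meets A₁) (meets A₂) Q) =
    Σ-mono Q λ {q} q∈Q → step q (separated q∈Q)
    where
    step : ∀ q → Disjoint q A₁ ⊎ Disjoint q A₂ → meets A₁ q ℕ.+ meets A₂ q ℕ.≤ meets A q
    step q (inj₁ q∩A₁=∅) rewrite meets-no q∩A₁=∅ = meets-mono q A₂⊆A
    step q (inj₂ q∩A₂=∅) rewrite meets-no q∩A₂=∅ | ℕ.+-identityʳ (meets A₁ q) = meets-mono q A₁⊆A

  cells-empty : ∀ {A} → Empty A → cells Q A ≡ 0
  cells-empty {A} A=∅ rewrite cells≡Σ Q A =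
    Σ-0 Q λ {q} _ → meets-no λ (x , x∈) → A=∅ (x , p∩q⊆q q A x∈)

  cells-pos : ∀ {A} → (∀ x → Any (x ∈ˢ_) Q) → Nonempty A → 1 ℕ.≤ cells Q A
  cells-pos {A} cover (x , x∈A) rewrite cells≡Σ Q A with find (cover x)
  ... | q , q∈Q , x∈q =
    ℕ.≤-trans (ℕ.≤-reflexive (sym (meets-yes {A = A} {q} (x , x∈p∩q⁺ (x∈q , x∈A))))) (Σ-∈ (meets A) q∈Q)

-- All other members of `Q` are disjoint from `q`, hence from `A`.
cells-⊆ : ∀ {Q : List (Subset n)} {A q} → AllPairs Disjoint Q → q ∈ Q → A ⊆ q → cells Q A ℕ.≤ 1
cells-⊆ {Q = Q} {A} {q} disj q∈Q A⊆q rewrite cells≡Σ Q A = go Q disj q∈Q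
  where
  meets-⊆ : ∀ {B} → Disjoint B q → meets A B ≡ 0
  meets-⊆ B∩q=∅ = meets-no (∉⇒disjoint λ x∈B x∈A → disjoint⇒∉ B∩q=∅ x∈B (A⊆q x∈A))
  meets≤1 : ∀ B → meets A B ℕ.≤ 1
  meets≤1 B with nonempty? (B ∩ A)
  ... | yes _ = s≤s z≤n
  ... | no  _ = z≤n
  go : ∀ Q → AllPairs Disjoint Q → q ∈ Q → Σ (meets A) Q ℕ.≤ 1
  go (B ∷ Q) (B∩ ∷ disj) (here refl)
    rewrite Σ-0 {f = meets A} Q (λ B′∈Q → meets-⊆ (Disjoint-sym (All.lookup B∩ B′∈Q)))
          | ℕ.+-identityʳ (meets A B) = meets≤1 B
  go (B ∷ Q) (B∩ ∷ disj) (there q∈Q) rewrite meets-⊆ (All.lookup B∩ q∈Q) = go Q disj q∈Q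

module _ (C : Clustering n) where

  cluster-unique : ∀ {A B x} → A ∈ clusters C → B ∈ clusters C → x ∈ˢ A → x ∈ˢ B → A ≡ B
  cluster-unique A∈C B∈C x∈A x∈B with AllPairs-lookup Disjoint-sym (disjoint C) A∈C B∈C
  ... | inj₁ A≡B   = A≡B
  ... | inj₂ A∩B=∅ = ⊥-elim (disjoint⇒∉ A∩B=∅ x∈A x∈B)

  cluster-of : ∀ x → ∃[ A ] A ∈ clusters C × x ∈ˢ A
  cluster-of x = find (covering C x)

  -- Both sides count the pairs of clusters, one from each clustering, that meet.
  Σ-cells≤dist+# : ∀ C′ → Σ (cells (clusters C)) (clusters C′) ℕ.≤ dist C C′ ℕ.+ # C
  Σ-cells≤dist+# C′ = begin
    Σ (cells (clusters C)) (clusters C′)               ≤⟨ Σ-mono (clusters C′) (λ {A} _ → ℕ.≤-reflexive (cells≡Σ (clusters C) A)) ⟩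
    Σ (λ A → Σ (meets A) (clusters C)) (clusters C′)   ≡⟨ Σ-meets-swap (clusters C′) (clusters C) ⟩
    Σ (λ B → Σ (meets B) (clusters C′)) (clusters C)   ≤⟨ Σ-mono (clusters C) (λ {B} _ → pred+1 B) ⟩
    Σ (λ B → (cells (clusters C′) B ∸ 1) ℕ.+ 1) (clusters C)
      ≡⟨ Σ-+ (λ B → cells (clusters C′) B ∸ 1) (λ _ → 1) (clusters C) ⟩
    dist C C′ ℕ.+ Σ (λ _ → 1) (clusters C)              ≡⟨ cong (dist C C′ ℕ.+_) (Σ-1 (clusters C)) ⟩
    dist C C′ ℕ.+ # C                                   ∎
    where
    open ℕ.≤-Reasoning
    pred+1 : ∀ B → Σ (meets B) (clusters C′) ℕ.≤ (cells (clusters C′) B ∸ 1) ℕ.+ 1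
    pred+1 B rewrite sym (cells≡Σ (clusters C′) B) | ℕ.+-comm (cells (clusters C′) B ∸ 1) 1 =
      ℕ.m≤n+m∸n (cells (clusters C′) B) 1

-- Average linkage

module IndicatorSums {c ℓ₁ ℓ₂ : Level} (F : OrderedField c ℓ₁ ℓ₂) where
  open OrderedField F
  open OrderedFieldProperties F
  open Sum semiring using (∑-comm; sum-cong-≋; sum-replicate-zero)

  ∑∈ : ∀ {n} → Subset n → (Fin n → Carrier) → Carrier
  ∑∈ A u = ∑ λ y → if lookup A y then u y else 0#

  ∑∈-∅ : ∀ n u → ∑∈ {n} ∅ u ≈ 0#
  ∑∈-∅ zero    u = ≈-refl
  ∑∈-∅ (suc n) u = ≈-trans (+-identityˡ _) (∑∈-∅ n λ y → u (suc y))

  ∑∈-⁅⁆ : ∀ {n} (x : Fin n) u → ∑∈ ⁅ x ⁆ u ≈ u x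
  ∑∈-⁅⁆ {suc n} zero u = ≈-trans (+-congˡ (∑∈-∅ n λ y → u (suc y))) (+-identityʳ (u zero))
  ∑∈-⁅⁆ (suc x)      u = ≈-trans (+-identityˡ _) (∑∈-⁅⁆ x λ y → u (suc y))

  ∑∈-split : ∀ {n} (A B : Subset n) u → ∑∈ A u ≈ ∑∈ (A ∩ B) u + ∑∈ (A ─ B) u
  ∑∈-split []      []      u = ≈-sym (+-identityʳ 0#)
  ∑∈-split (a ∷ A) (b ∷ B) u = begin-equality
    u₀ a + ∑∈ A u′                                   ≈⟨ +-cong (head a b) (∑∈-split A B u′) ⟩
    (u₀ (a∧b a b) + u₀ (a─b a b)) + (∑∈ (A ∩ B) u′ + ∑∈ (A ─ B) u′)
                                                     ≈⟨ middle (u₀ (a∧b a b)) (u₀ (a─b a b)) _ _ ⟩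
    (u₀ (a∧b a b) + ∑∈ (A ∩ B) u′) + (u₀ (a─b a b) + ∑∈ (A ─ B) u′) ≈⟨ fold a b ⟩
    ∑∈ ((a ∷ A) ∩ (b ∷ B)) u + ∑∈ ((a ∷ A) ─ (b ∷ B)) u ∎
    where
    open ≤-Reasoning
    u₀ : _ → Carrier
    u₀ s = if s then u zero else 0#
    u′ = λ y → u (suc y)
    -- The head bits of `A ∩ B` and of `A ─ B`. Once both bits are known they agree by computation,
    -- so `fold` is reflexivity in every case.
    a∧b : _ → _ → _
    a∧b true  b = b
    a∧b false b = false
    a─b : _ → _ → _
    a─b a true  = false
    a─b a false = a
    head : ∀ a b → u₀ a ≈ u₀ (a∧b a b) + u₀ (a─b a b)
    head true  true  = ≈-sym (+-identityʳ _)
    head true  false = ≈-sym (+-identityˡ _)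
    head false true  = ≈-sym (+-identityʳ _)
    head false false = ≈-sym (+-identityʳ _)
    middle : ∀ w x y z → (w + x) + (y + z) ≈ (w + y) + (x + z)
    middle w x y z = begin-equality
      (w + x) + (y + z) ≈⟨ +-assoc w x (y + z) ⟩
      w + (x + (y + z)) ≈⟨ +-congˡ (+-assoc x y z) ⟨
      w + (x + y + z)   ≈⟨ +-congˡ (+-congʳ (+-comm x y)) ⟩
      w + (y + x + z)   ≈⟨ +-congˡ (+-assoc y x z) ⟩
      w + (y + (x + z)) ≈⟨ +-assoc w y (x + z) ⟨
      (w + y) + (x + z) ∎
    fold : ∀ a b → (u₀ (a∧b a b) + ∑∈ (A ∩ B) u′) + (u₀ (a─b a b) + ∑∈ (A ─ B) u′)
                   ≈ ∑∈ ((a ∷ A) ∩ (b ∷ B)) u + ∑∈ ((a ∷ A) ─ (b ∷ B)) u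
    fold true  true  = ≈-refl
    fold true  false = ≈-refl
    fold false true  = ≈-refl
    fold false false = ≈-refl

  module _ {d : Carrier} where

    private
      suc-* : ∀ m → d + d * fromℕ m ≈ d * fromℕ (suc m)
      suc-* m = begin-equality
        d + d * fromℕ m      ≈⟨ +-congʳ (*-identityʳ d) ⟨
        d * 1# + d * fromℕ m ≈⟨ distribˡ d 1# (fromℕ m) ⟨
        d * fromℕ (suc m)    ∎
        where open ≤-Reasoning

    ∑∈-≤ : ∀ {n} (A : Subset n) {u} → (∀ {y} → y ∈ˢ A → u y < d) → ∑∈ A u ≤ d * fromℕ ∣ A ∣
    ∑∈-≤ []            u<d = ≈⇒≤ (≈-sym (zeroʳ d))
    ∑∈-≤ (outside ∷ A) u<d = ≤-trans (≈⇒≤ (+-identityˡ _)) (∑∈-≤ A λ y∈A → u<d (there y∈A))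
    ∑∈-≤ (inside  ∷ A) u<d = ≤-trans
      (+-mono-≤ (<⇒≤ (u<d here)) (∑∈-≤ A λ y∈A → u<d (there y∈A))) (≈⇒≤ (suc-* ∣ A ∣))

    ∑∈-< : ∀ {n} (A : Subset n) {u} → Nonempty A → (∀ {y} → y ∈ˢ A → u y < d) →
           ∑∈ A u < d * fromℕ ∣ A ∣
    ∑∈-< (outside ∷ A) (suc x , there x∈A) u<d =
      ≤-<-trans (≈⇒≤ (+-identityˡ _)) (∑∈-< A (x , x∈A) λ y∈A → u<d (there y∈A))
    ∑∈-< (inside  ∷ A) _ u<d = <-≤-trans
      (+-mono-<-≤ (u<d here) (∑∈-≤ A λ y∈A → u<d (there y∈A))) (≈⇒≤ (suc-* ∣ A ∣))

    -- A mean over `G` is a weighted mean of the means over the pieces that make up `G`, so a common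
    -- bound `d` carries over. Pieces that miss `G` are skipped; the others are peeled off one at a
    -- time. In the application `G` is the rest of a target cluster and the pieces are the current
    -- trees.
    ∑∈-cover : ∀ {n u} (G : Subset n) ps → AllPairs Disjoint ps →
               (∀ {x} → x ∈ˢ G → Any (x ∈ˢ_) ps) →
               (∀ {p} → p ∈ ps → Disjoint p G ⊎ p ⊆ G × ∑∈ p u ≤ d * fromℕ ∣ p ∣) →
               ∑∈ G u ≤ d * fromℕ ∣ G ∣
    ∑∈-cover {n} {u} G [] _ cover _
      rewrite Empty-unique {p = G} (λ (x , x∈G) → Any.¬Any[] (cover x∈G)) | ∣⊥∣≡0 n =
      ≈⇒≤ (≈-trans (∑∈-∅ n u) (≈-sym (zeroʳ d)))
    ∑∈-cover {n} {u} G (p ∷ ps) (p∩ ∷ disj) cover bound with bound (here refl)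
    ... | inj₁ p∩G=∅ = ∑∈-cover G ps disj
          (λ x∈G → Any.tail (λ x∈p → disjoint⇒∉ p∩G=∅ x∈p x∈G) (cover x∈G))
          (λ r∈ps → bound (there r∈ps))
    ... | inj₂ (p⊆G , ∑p≤) = begin
      ∑∈ G u                                    ≈⟨ ∑∈-split G p u ⟩
      ∑∈ (G ∩ p) u + ∑∈ (G ─ p) u               ≡⟨ cong (λ r → ∑∈ r u + ∑∈ (G ─ p) u) (p⊆q⇒q∩p≡p p G p⊆G) ⟩
      ∑∈ p u + ∑∈ (G ─ p) u                     ≤⟨ +-mono-≤ ∑p≤ (∑∈-cover (G ─ p) ps disj cover′ bound′) ⟩
      d * fromℕ ∣ p ∣ + d * fromℕ ∣ G ─ p ∣     ≈⟨ distribˡ d (fromℕ ∣ p ∣) (fromℕ ∣ G ─ p ∣) ⟨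
      d * (fromℕ ∣ p ∣ + fromℕ ∣ G ─ p ∣)       ≈⟨ *-congˡ (fromℕ-+ ∣ p ∣ ∣ G ─ p ∣) ⟨
      d * fromℕ (∣ p ∣ ℕ.+ ∣ G ─ p ∣)           ≡⟨ cong (λ m → d * fromℕ m) sizes ⟩
      d * fromℕ ∣ G ∣                           ∎
      where
      open ≤-Reasoning
      sizes : ∣ p ∣ ℕ.+ ∣ G ─ p ∣ ≡ ∣ G ∣
      sizes = trans (cong (λ r → ∣ r ∣ ℕ.+ ∣ G ─ p ∣) (sym (p⊆q⇒q∩p≡p p G p⊆G))) (∣p∩q∣+∣p─q∣≡∣p∣ G p)
      cover′ : ∀ {x} → x ∈ˢ G ─ p → Any (x ∈ˢ_) ps
      cover′ x∈ = Any.tail (x∈p─q⇒x∉q G p x∈) (cover (p─q⊆p G p x∈))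
      bound′ : ∀ {r} → r ∈ ps → Disjoint r (G ─ p) ⊎ r ⊆ G ─ p × ∑∈ r u ≤ d * fromℕ ∣ r ∣
      bound′ {r} r∈ps with bound (there r∈ps)
      ... | inj₁ r∩G=∅ = inj₁ (∉⇒disjoint λ x∈r x∈ → disjoint⇒∉ r∩G=∅ x∈r (p─q⊆p G p x∈))
      ... | inj₂ (r⊆G , ∑r≤) = inj₂ ((λ x∈r → x∈p∧x∉q⇒x∈p─q (r⊆G x∈r)
              λ x∈p → disjoint⇒∉ (All.lookup p∩ r∈ps) x∈p x∈r) , ∑r≤)

  module Averages {n : ℕ} (S : Fin n → Fin n → Carrier) where
    open Similarity F S

    -- With one set fixed, an average becomes a sum over the other set alone, and such sums are
    -- additive over disjoint sets.
    attraction : Subset n → Fin n → Carrier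
    attraction A y = ∑∈ A λ x → S x y

    private
      term : Subset n → Subset n → Fin n → Fin n → Carrier
      term A B x y = if lookup A x then (if lookup B y then S x y else 0#) else 0#

    ∑∑≈∑∈-attraction : ∀ A B → ∑ (λ x → ∑ (term A B x)) ≈ ∑∈ B (attraction A)
    ∑∑≈∑∈-attraction A B = ≈-trans (∑-comm (term A B)) (sum-cong-≋ column)
      where
      column : ∀ y → ∑ (λ x → term A B x y) ≈ (if lookup B y then attraction A y else 0#)
      column y with lookup B y
      ... | true  = ≈-refl
      ... | false = ≈-trans (sum-cong-≋ zeros) (sum-replicate-zero n)
        where
        zeros : ∀ x → (if lookup A x then 0# else 0#) ≈ 0#
        zeros x with lookup A x
        ... | true  = ≈-refl
        ... | false = ≈-refl

    ∑∑-sym : Symmetric → ∀ A B → ∑ (λ x → ∑ (term A B x)) ≈ ∑ (λ y → ∑ (term B A y))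
    ∑∑-sym symmetric A B = ≈-trans (∑-comm (term A B)) (sum-cong-≋ λ y → sum-cong-≋ λ x → swap y x)
      where
      swap : ∀ y x → term A B x y ≈ term B A y x
      swap y x with lookup A x | lookup B y
      ... | true  | true  = symmetric x y
      ... | true  | false = ≈-refl
      ... | false | true  = ≈-refl
      ... | false | false = ≈-refl

    average-sym : Symmetric → ∀ A B → average A B ≈ average B A
    average-sym symmetric A B rewrite ℕ.*-comm ∣ A ∣ ∣ B ∣ = *-congʳ (∑∑-sym symmetric A B)

    ∑∈-attraction : ∀ {A B} → Nonempty A → Nonempty B →
                    ∑∈ B (attraction A) ≈ average A B * fromℕ ∣ A ∣ * fromℕ ∣ B ∣
    ∑∈-attraction {A} {B} A≠∅ B≠∅ = begin-equality
      ∑∈ B (attraction A)                     ≈⟨ ∑∑≈∑∈-attraction A B ⟨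
      total                                   ≈⟨ *-identityʳ total ⟨
      total * 1#                              ≈⟨ *-congˡ (pos⇒x⁻¹*x≈1 0<size) ⟨
      total * (size ⁻¹ * size)                ≈⟨ *-assoc total (size ⁻¹) size ⟨
      average A B * size                      ≈⟨ *-congˡ (fromℕ-* ∣ A ∣ ∣ B ∣) ⟩
      average A B * (fromℕ ∣ A ∣ * fromℕ ∣ B ∣) ≈⟨ *-assoc (average A B) _ _ ⟨
      average A B * fromℕ ∣ A ∣ * fromℕ ∣ B ∣ ∎
      where
      open ≤-Reasoning
      total = ∑ (λ x → ∑ (term A B x))
      size = fromℕ (∣ A ∣ ℕ.* ∣ B ∣)
      0<size : 0# < size
      0<size = fromℕ-pos (ℕ.*-mono-≤ (nonempty⇒1≤∣p∣ A≠∅) (nonempty⇒1≤∣p∣ B≠∅))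

    module _ {A : Subset n} (A≠∅ : Nonempty A) {v : Carrier} where

      private
        0<∣_∣ : ∀ {B : Subset n} → Nonempty B → 0# < fromℕ ∣ B ∣
        0<∣ B≠∅ ∣ = fromℕ-pos (nonempty⇒1≤∣p∣ B≠∅)

      average≤⇒∑∈≤ : ∀ {B} → Nonempty B → average A B ≤ v →
                     ∑∈ B (attraction A) ≤ v * fromℕ ∣ A ∣ * fromℕ ∣ B ∣
      average≤⇒∑∈≤ B≠∅ avg≤v = ≤-trans (≈⇒≤ (∑∈-attraction A≠∅ B≠∅))
        (*-monoʳ-≤ (<⇒≤ 0<∣ B≠∅ ∣) (*-monoʳ-≤ (<⇒≤ 0<∣ A≠∅ ∣) avg≤v))

      ∑∈≤⇒average≤ : ∀ {B} → Nonempty B → ∑∈ B (attraction A) ≤ v * fromℕ ∣ A ∣ * fromℕ ∣ B ∣ →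
                     average A B ≤ v
      ∑∈≤⇒average≤ B≠∅ ∑≤ = *-cancelʳ-≤ 0<∣ A≠∅ ∣ (*-cancelʳ-≤ 0<∣ B≠∅ ∣
        (≤-trans (≈⇒≤ (≈-sym (∑∈-attraction A≠∅ B≠∅))) ∑≤))

      -- Stability compares only with subsets of a single target cluster, whereas a tree outside `q`
      -- may be a union of several. Singletons are always within its reach, and `∑∈-<` sums the
      -- pointwise inequalities over the tree.
      average-⁅⁆<⇒attraction< : ∀ {y} → average A ⁅ y ⁆ < v → attraction A y < v * fromℕ ∣ A ∣
      average-⁅⁆<⇒attraction< {y} avg<v = begin-strict
        attraction A y                              ≈⟨ ∑∈-⁅⁆ y (attraction A) ⟨
        ∑∈ ⁅ y ⁆ (attraction A)                     ≈⟨ ∑∈-attraction A≠∅ (y , x∈⁅x⁆ y) ⟩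
        average A ⁅ y ⁆ * fromℕ ∣ A ∣ * fromℕ ∣ ⁅ y ⁆ ∣
          ≈⟨ ≈-trans (*-congˡ (≈-trans (≈⇒1 y) fromℕ-1)) (*-identityʳ _) ⟩
        average A ⁅ y ⁆ * fromℕ ∣ A ∣               <⟨ *-monoʳ-< 0<∣ A≠∅ ∣ avg<v ⟩
        v * fromℕ ∣ A ∣                             ∎
        where
        open ≤-Reasoning
        ≈⇒1 : ∀ y → fromℕ ∣ ⁅ y ⁆ ∣ ≈ fromℕ 1
        ≈⇒1 y rewrite ∣⁅x⁆∣≡1 y = ≈-refl

-- Laminar sets, dendrograms and depth in a tree

module Laminarity {n : ℕ} (C* : Clustering n) where

  -- Since the target clusters cover all points, this says that `A` is a union of target clusters,
  -- without naming the subfamily.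
  Saturated : Subset n → Set
  Saturated A = ∀ {q} → q ∈ clusters C* → Nonempty (q ∩ A) → q ⊆ A

  Laminar : Subset n → Set
  Laminar A = (∃[ q ] q ∈ clusters C* × A ⊆ q) ⊎ Saturated A

  -- A leaf carries no condition, since a singleton always lies inside the target cluster of its
  -- point.
  Dendrogram : Tree n → Set
  Dendrogram (leaf x)     = ⊤
  Dendrogram (node t₁ t₂) =
    Laminar (points t₁ ∪ points t₂) × Disjoint (points t₁) (points t₂) × Dendrogram t₁ × Dendrogram t₂

  laminar : ∀ t → Dendrogram t → Laminar (points t)
  laminar (leaf x) _ with cluster-of C* x
  ... | q , q∈ , x∈q = inj₁ (q , q∈ , λ y∈ → subst (_∈ˢ q) (sym (x∈⁅y⁆⇒x≡y x y∈)) x∈q)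
  laminar (node t₁ t₂) (l , _) = l

  meets-laminar : ∀ {A q} → Laminar A → q ∈ clusters C* → Nonempty (q ∩ A) → A ⊆ q ⊎ q ⊆ A
  meets-laminar {A} {q} (inj₁ (q′ , q′∈ , A⊆q′)) q∈ (x , x∈) with x∈p∩q⁻ q A x∈
  ... | x∈q , x∈A with cluster-unique C* q∈ q′∈ x∈q (A⊆q′ x∈A)
  ...   | refl = inj₁ A⊆q′
  meets-laminar (inj₂ saturated) q∈ q∩A≠∅ = inj₂ (saturated q∈ q∩A≠∅)

  ∪-saturated : ∀ {A B} → Saturated A → Saturated B → Saturated (A ∪ B)
  ∪-saturated {A} {B} satA satB {q} q∈ (x , x∈) with x∈p∩q⁻ q (A ∪ B) x∈
  ... | x∈q , x∈A∪B with x∈p∪q⁻ A B x∈A∪B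
  ...   | inj₁ x∈A = λ y∈q → p⊆p∪q B (satA q∈ (x , x∈p∩q⁺ (x∈q , x∈A)) y∈q)
  ...   | inj₂ x∈B = λ y∈q → q⊆p∪q A B (satB q∈ (x , x∈p∩q⁺ (x∈q , x∈B)) y∈q)

points-nonempty : ∀ {n} (t : Tree n) → Nonempty (points t)
points-nonempty (leaf x)     = x , x∈⁅x⁆ x
points-nonempty (node t₁ t₂) with points-nonempty t₁
... | x , x∈t₁ = x , p⊆p∪q (points t₂) x∈t₁

NodeAt⇒⊆ : ∀ {n d} {t s : Tree n} → NodeAt t d s → points s ⊆ points t
NodeAt⇒⊆ here                    x∈s = x∈s
NodeAt⇒⊆ (left  {t₂ = t₂} at)    x∈s = p⊆p∪q (points t₂) (NodeAt⇒⊆ at x∈s)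
NodeAt⇒⊆ (right {t₁} {t₂} at)    x∈s = q⊆p∪q (points t₁) (points t₂) (NodeAt⇒⊆ at x∈s)

module _ {n : ℕ} {p : Level} {P : Subset n → Set p} (P? : Decidable P) where

  deepest? : ∀ t → (∃[ N ] IsDeepest t P N) ⊎ (∀ d N → NodeAt t d N → ¬ P (points N))
  deepest? (leaf x) with P? ⁅ x ⁆
  ... | yes p = inj₁ (leaf x , 0 , here , p , λ { .0 _ here _ → z≤n })
  ... | no ¬p = inj₂ λ { .0 _ here → ¬p }
  deepest? (node t₁ t₂) with deepest? t₁ | deepest? t₂
  ... | inj₁ (N₁ , d₁ , at₁ , p₁ , max₁) | inj₁ (N₂ , d₂ , at₂ , p₂ , max₂) with ℕ.≤-total d₁ d₂
  ...   | inj₁ d₁≤d₂ = inj₁ (N₂ , suc d₂ , right at₂ , p₂ , λ where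
            _ _ here       _ → z≤n
            _ N (left at)  p → s≤s (ℕ.≤-trans (max₁ _ N at p) d₁≤d₂)
            _ N (right at) p → s≤s (max₂ _ N at p))
  ...   | inj₂ d₂≤d₁ = inj₁ (N₁ , suc d₁ , left at₁ , p₁ , λ where
            _ _ here       _ → z≤n
            _ N (left at)  p → s≤s (max₁ _ N at p)
            _ N (right at) p → s≤s (ℕ.≤-trans (max₂ _ N at p) d₂≤d₁))
  deepest? (node t₁ t₂) | inj₁ (N₁ , d₁ , at₁ , p₁ , max₁) | inj₂ none₂ =
    inj₁ (N₁ , suc d₁ , left at₁ , p₁ , λ where
      _ _ here       _ → z≤n
      _ N (left at)  p → s≤s (max₁ _ N at p)
      _ N (right at) p → ⊥-elim (none₂ _ N at p))
  deepest? (node t₁ t₂) | inj₂ none₁ | inj₁ (N₂ , d₂ , at₂ , p₂ , max₂) =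
    inj₁ (N₂ , suc d₂ , right at₂ , p₂ , λ where
      _ _ here       _ → z≤n
      _ N (left at)  p → ⊥-elim (none₁ _ N at p)
      _ N (right at) p → s≤s (max₂ _ N at p))
  deepest? (node t₁ t₂) | inj₂ none₁ | inj₂ none₂ with P? (points t₁ ∪ points t₂)
  ...   | yes p = inj₁ (node t₁ t₂ , 0 , here , p , λ where
            _ _ here       _ → z≤n
            _ N (left at)  p → ⊥-elim (none₁ _ N at p)
            _ N (right at) p → ⊥-elim (none₂ _ N at p))
  ...   | no ¬p = inj₂ λ where
            _ _ here       → ¬p
            _ N (left at)  → none₁ _ N at
            _ N (right at) → none₂ _ N at

  deepest : ∀ t → P (points t) → ∃[ N ] IsDeepest t P N
  deepest t p with deepest? t
  ... | inj₁ found = found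
  ... | inj₂ none  = ⊥-elim (none 0 t here p)

NodeAt-children : ∀ {n d} {t t₁ t₂ : Tree n} → NodeAt t d (node t₁ t₂) → NodeAt t (suc d) t₁ × NodeAt t (suc d) t₂
NodeAt-children here       = left here , right here
NodeAt-children (left at)  with at₁ , at₂ ← NodeAt-children at = left at₁ , left at₂
NodeAt-children (right at) with at₁ , at₂ ← NodeAt-children at = right at₁ , right at₂

-- If `A` missed one child, the other child would contain `A` and lie one level deeper.
deepest-meets-children : ∀ {n} {t t₁ t₂ : Tree n} {A} → IsDeepest t (A ⊆_) (node t₁ t₂) →
                         Nonempty (A ∩ points t₁) × Nonempty (A ∩ points t₂)
deepest-meets-children {t₁ = t₁} {t₂} {A} (d , at , A⊆ , max) with NodeAt-children at
... | at₁ , at₂ with nonempty? (A ∩ points t₁) | nonempty? (A ∩ points t₂)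
...   | yes A∩t₁≠∅ | yes A∩t₂≠∅ = A∩t₁≠∅ , A∩t₂≠∅
...   | no  A∩t₁=∅ | _ = ⊥-elim (ℕ.<-irrefl refl (max (suc d) t₂ at₂ (⊆∪-disjointˡ A⊆ A∩t₁=∅)))
...   | yes _ | no A∩t₂=∅ = ⊥-elim (ℕ.<-irrefl refl (max (suc d) t₁ at₁ (⊆∪-disjointʳ A⊆ A∩t₂=∅)))

module Dendrograms {n : ℕ} (C* : Clustering n) where
  open Laminarity C*

  Dendrogram-subtree : ∀ {d t s} → Dendrogram t → NodeAt t d s → Dendrogram s
  Dendrogram-subtree dt here = dt
  Dendrogram-subtree (_ , _ , dt₁ , _) (left at)  = Dendrogram-subtree dt₁ at
  Dendrogram-subtree (_ , _ , _ , dt₂) (right at) = Dendrogram-subtree dt₂ at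

  -- Siblings are disjoint, so two nodes with a common point lie on one path from the root, and the
  -- one at smaller depth is the ancestor.
  deeper⇒⊆ : ∀ {d e t r s x} → Dendrogram t → NodeAt t d r → NodeAt t e s → e ℕ.≤ d →
             x ∈ˢ points r → x ∈ˢ points s → points r ⊆ points s
  deeper⇒⊆ _ atr here _ _ _ = NodeAt⇒⊆ atr
  deeper⇒⊆ (_ , _ , dt₁ , _) (left atr)  (left ats)  (s≤s e≤d) x∈r x∈s = deeper⇒⊆ dt₁ atr ats e≤d x∈r x∈s
  deeper⇒⊆ (_ , _ , _ , dt₂) (right atr) (right ats) (s≤s e≤d) x∈r x∈s = deeper⇒⊆ dt₂ atr ats e≤d x∈r x∈s
  deeper⇒⊆ (_ , t₁∩t₂=∅ , _) (left atr)  (right ats) _ x∈r x∈s =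
    ⊥-elim (disjoint⇒∉ t₁∩t₂=∅ (NodeAt⇒⊆ atr x∈r) (NodeAt⇒⊆ ats x∈s))
  deeper⇒⊆ (_ , t₁∩t₂=∅ , _) (right atr) (left ats)  _ x∈r x∈s =
    ⊥-elim (disjoint⇒∉ t₁∩t₂=∅ (NodeAt⇒⊆ ats x∈s) (NodeAt⇒⊆ atr x∈r))

  -- Neither child contains q, since the other one meets q as well; by laminarity q
  -- contains both.
  straddling⇒⊇ : ∀ {t₁ t₂ q} → Dendrogram (node t₁ t₂) → q ∈ clusters C* →
                 Nonempty (q ∩ points t₁) → Nonempty (q ∩ points t₂) → points t₁ ∪ points t₂ ⊆ q
  straddling⇒⊇ {t₁} {t₂} {q} (_ , t₁∩t₂=∅ , dt₁ , dt₂) q∈ q∩t₁≠∅@(x₁ , x₁∈) q∩t₂≠∅@(x₂ , x₂∈)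
    with meets-laminar (laminar t₁ dt₁) q∈ q∩t₁≠∅ | meets-laminar (laminar t₂ dt₂) q∈ q∩t₂≠∅
  ... | inj₂ q⊆t₁ | _         =
        ⊥-elim (disjoint⇒∉ t₁∩t₂=∅ (q⊆t₁ (p∩q⊆p q (points t₂) x₂∈)) (p∩q⊆q q (points t₂) x₂∈))
  ... | inj₁ _    | inj₂ q⊆t₂ =
        ⊥-elim (disjoint⇒∉ t₁∩t₂=∅ (p∩q⊆q q (points t₁) x₁∈) (q⊆t₂ (p∩q⊆p q (points t₁) x₁∈)))
  ... | inj₁ t₁⊆q | inj₁ t₂⊆q = ∪-⊆ t₁⊆q t₂⊆q

  -- The witness is the deepest node containing `q`. Both of its children meet `q`, so laminarity
  -- puts the whole node inside `q`.
  cluster-is-node : ∀ {t q} → Dendrogram t → (∀ x → x ∈ˢ points t) → q ∈ clusters C* →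
                    ∃[ d ] ∃[ N ] NodeAt t d N × points N ≡ q
  cluster-is-node {t} {q} dt cover q∈ with deepest (q ⊆?_) t (λ {x} _ → cover x)
  -- A target cluster inside a singleton is that singleton, because it is nonempty.
  ... | leaf x , d , at , q⊆x , _ = d , leaf x , at , ⊆-antisym x⊆q q⊆x
    where
    x⊆q : ⁅ x ⁆ ⊆ q
    x⊆q y∈ with All.lookup (nonempty C*) q∈
    ... | z , z∈q rewrite x∈⁅y⁆⇒x≡y x y∈ | sym (x∈⁅y⁆⇒x≡y x (q⊆x z∈q)) = z∈q
  ... | N@(node t₁ t₂) , isDeepest@(d , at , q⊆ , _) = d , N , at ,
        ⊆-antisym (straddling⇒⊇ (Dendrogram-subtree dt at) q∈ (proj₁ meets-both) (proj₂ meets-both)) q⊆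
    where
    meets-both = deepest-meets-children isDeepest

module AverageLinkage {c ℓ₁ ℓ₂ : Level} (F : OrderedField c ℓ₁ ℓ₂) {n : ℕ}
  (S : Fin n → Fin n → OrderedField.Carrier F) (symmetric : Similarity.Symmetric F S)
  (C* : Clustering n) (stable : Similarity.Stable F S C*) where
  open OrderedField F
  open Similarity F S
  open OrderedFieldProperties F
  open IndicatorSums F
  open Averages S
  open Laminarity C*

  Forest = List (Tree n)

  record IsDendrogramForest (f : Forest) : Set where
    field
      dendrograms : All Dendrogram f
      separate    : AllPairs (λ s t → Disjoint (points s) (points t)) f
      spanning    : ∀ x → Any (λ t → x ∈ˢ points t) f

  open IsDendrogramForest

  -- If t₁ is a proper part of q, the trees that make up q ─ t₁ attract t₁ at most
  -- as much as t₂ does, hence so does q ─ t₁.  By stability q ─ t₁ attracts t₁ more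
  -- than any single point outside q, so t₂ cannot lie outside q.
  link-inside : ∀ {f t₁ t₂ others q v} → IsDendrogramForest f → f ↭ t₁ ∷ others → t₂ ∈ others →
                (∀ {s} → s ∈ others → average (points t₁) (points s) ≤ v) →
                v ≈ average (points t₁) (points t₂) →
                q ∈ clusters C* → points t₁ ⊂ q → ¬ Disjoint (points t₂) q
  link-inside {f} {t₁} {t₂} {others} {q} {v} isForest f↭ t₂∈ avg≤v v≈avg q∈ A⊂q@(A⊆q , z , z∈q , z∉A) B∩q=∅ =
    irrefl (≈-trans (∑∈-attraction A≠∅ B≠∅) (*-congʳ (*-congʳ (≈-sym v≈avg))))
           (∑∈-< B B≠∅ λ y∈B → average-⁅⁆<⇒attraction< A≠∅ (far y∈B))
    where
    A = points t₁
    B = points t₂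
    A≠∅ = points-nonempty t₁
    B≠∅ = points-nonempty t₂
    separate′ = AllPairs-resp-↭ Disjoint-sym f↭ (separate isForest)

    A∩s=∅ : ∀ {s} → s ∈ others → Disjoint A (points s)
    A∩s=∅ s∈ = All.lookup (AllPairs.head separate′) s∈

    cover : ∀ {x} → x ∈ˢ q ─ A → Any (x ∈ˢ_) (map points others)
    cover {x} x∈ = Any.map⁺ (Any.tail (x∈p─q⇒x∉q q A x∈) (Any-resp-↭ f↭ (spanning isForest x)))

    bound : ∀ {p} → p ∈ map points others →
            Disjoint p (q ─ A) ⊎ p ⊆ q ─ A × ∑∈ p (attraction A) ≤ v * fromℕ ∣ A ∣ * fromℕ ∣ p ∣
    bound p∈ with ∈-map⁻ points p∈
    ... | s , s∈ , refl with nonempty? (q ∩ points s)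
    ...   | no  q∩s=∅ = inj₁ (∉⇒disjoint λ x∈s x∈ → disjoint⇒∉ q∩s=∅ (p─q⊆p q A x∈) x∈s)
    ...   | yes q∩s≠∅ with meets-laminar (laminar s (All.lookup (All-resp-↭ f↭ (dendrograms isForest)) (there s∈))) q∈ q∩s≠∅
    ...     | inj₂ q⊆s = ⊥-elim (disjoint⇒∉ (A∩s=∅ s∈) (proj₂ A≠∅) (q⊆s (A⊆q (proj₂ A≠∅))))
    ...     | inj₁ s⊆q = inj₂
                ( (λ x∈s → x∈p∧x∉q⇒x∈p─q (s⊆q x∈s) λ x∈A → disjoint⇒∉ (A∩s=∅ s∈) x∈A x∈s)
                , average≤⇒∑∈≤ A≠∅ (points-nonempty s) (avg≤v s∈))

    average-rest≤v : average A (q ─ A) ≤ v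
    average-rest≤v = ∑∈≤⇒average≤ A≠∅ (z , x∈p∧x∉q⇒x∈p─q z∈q z∉A)
      (∑∈-cover (q ─ A) (map points others) (AllPairs.map⁺ (AllPairs.tail separate′)) cover bound)

    far : ∀ {y} → y ∈ˢ B → average A ⁅ y ⁆ < v
    far {y} y∈B with cluster-of C* y
    ... | q′ , q′∈ , y∈q′ = <-≤-trans
          (stable q∈ q′∈ (λ { refl → disjoint⇒∉ B∩q=∅ y∈B y∈q′ }) A A≠∅ A⊂q ⁅ y ⁆ (y , x∈⁅x⁆ y)
            λ x∈ → subst (_∈ˢ q′) (sym (x∈⁅y⁆⇒x≡y y x∈)) y∈q′)
          average-rest≤v

  -- Stability speaks of proper parts of a target cluster only, so a tree that equals a target
  -- cluster is moved to the saturated case.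
  saturated-or-inside : ∀ t → Dendrogram t →
                        Saturated (points t) ⊎ (∃[ q ] q ∈ clusters C* × points t ⊂ q)
  saturated-or-inside t dt with laminar t dt
  ... | inj₂ saturated = inj₁ saturated
  ... | inj₁ (q , q∈ , t⊆q) with q ⊆? points t
  ...   | yes q⊆t = inj₁ λ {q′} q′∈ (x , x∈) →
            let x∈q′ , x∈t = x∈p∩q⁻ q′ (points t) x∈
            in subst (_⊆ points t) (cluster-unique C* q∈ q′∈ (t⊆q x∈t) x∈q′) q⊆t
  ...   | no  q⊈t with nonempty? (q ─ points t)
  ...     | yes (z , z∈) = inj₂ (q , q∈ , t⊆q , z , p─q⊆p q (points t) z∈ , x∈p─q⇒x∉q q (points t) z∈)
  ...     | no  q─t=∅    = ⊥-elim (q⊈t (─-empty⇒⊆ q─t=∅))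

  -- By laminarity `t₂` could otherwise only contain `q`, and then it would meet `t₁`. The separate
  -- value `v` allows the two linked trees to be exchanged: maximality bounds averages by one fixed
  -- order of the pair, and the other order is only equal up to `≈`.
  joins-inside : ∀ {f t₁ t₂ others q v} → IsDendrogramForest f → f ↭ t₁ ∷ others → t₂ ∈ others →
                 (∀ {s} → s ∈ others → average (points t₁) (points s) ≤ v) →
                 v ≈ average (points t₁) (points t₂) →
                 q ∈ clusters C* → points t₁ ⊂ q → points t₂ ⊆ q
  joins-inside {t₁ = t₁} {t₂} {q = q} isForest f↭ t₂∈ avg≤v v≈avg q∈ t₁⊂q with nonempty? (q ∩ points t₂)
  ... | no  q∩t₂=∅ = ⊥-elim (link-inside isForest f↭ t₂∈ avg≤v v≈avg q∈ t₁⊂q (Disjoint-sym q∩t₂=∅))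
  ... | yes q∩t₂≠∅ with meets-laminar (laminar t₂ (All.lookup (All-resp-↭ f↭ (dendrograms isForest)) (there t₂∈))) q∈ q∩t₂≠∅
  ...   | inj₁ t₂⊆q = t₂⊆q
  ...   | inj₂ q⊆t₂ = ⊥-elim (disjoint⇒∉
            (All.lookup (AllPairs.head (AllPairs-resp-↭ Disjoint-sym f↭ (separate isForest))) t₂∈)
            (proj₂ (points-nonempty t₁)) (q⊆t₂ (proj₁ t₁⊂q (proj₂ (points-nonempty t₁)))))

  -- Two saturated trees have a saturated union. Otherwise one of them is a proper part of some `q`,
  -- and the maximality of the link draws the other into `q`.
  link-laminar : ∀ {f t₁ t₂ rest} → IsDendrogramForest f → f ↭ t₁ ∷ t₂ ∷ rest →
                 (∀ {s₁ s₂ rest′} → f ↭ s₁ ∷ s₂ ∷ rest′ →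
                   average (points s₁) (points s₂) ≤ average (points t₁) (points t₂)) →
                 Laminar (points t₁ ∪ points t₂)
  link-laminar {f} {t₁} {t₂} {rest} isForest f↭ maximal
    with dt₁ ∷ dt₂ ∷ _ ← All-resp-↭ f↭ (dendrograms isForest)
    with saturated-or-inside t₁ dt₁ | saturated-or-inside t₂ dt₂
  ... | inj₁ sat₁ | inj₁ sat₂ = inj₂ (∪-saturated sat₁ sat₂)
  ... | inj₂ (q , q∈ , t₁⊂q) | _ = inj₁ (q , q∈ , ∪-⊆ (proj₁ t₁⊂q) t₂⊆q)
    where
    t₂⊆q : points t₂ ⊆ q
    t₂⊆q = joins-inside isForest f↭ (here refl)
      (λ s∈ → maximal (↭-trans f↭ (↭-prep t₁ (proj₂ (∈⇒↭∷ s∈))))) ≈-refl q∈ t₁⊂q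
  ... | inj₁ _ | inj₂ (q , q∈ , t₂⊂q) = inj₁ (q , q∈ , ∪-⊆ t₁⊆q (proj₁ t₂⊂q))
    where
    f↭′ : f ↭ t₂ ∷ t₁ ∷ rest
    f↭′ = ↭-trans f↭ (↭-swap t₁ t₂ ↭-refl)
    t₁⊆q : points t₁ ⊆ q
    t₁⊆q = joins-inside isForest f↭′ (here refl)
      (λ s∈ → maximal (↭-trans f↭′ (↭-prep t₂ (proj₂ (∈⇒↭∷ s∈)))))
      (average-sym symmetric (points t₁) (points t₂)) q∈ t₂⊂q

  link-forest : ∀ {f f′} → IsDendrogramForest f → f ⟶ f′ → IsDendrogramForest f′
  link-forest isForest (link {t₁ = t₁} {t₂} f↭ maximal)
    with dt₁ ∷ dt₂ ∷ drest ← All-resp-↭ f↭ (dendrograms isForest)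
       | (t₁∩t₂=∅ ∷ t₁∩) ∷ t₂∩ ∷ rest∩ ← AllPairs-resp-↭ Disjoint-sym f↭ (separate isForest) = record
    { dendrograms = (link-laminar isForest f↭ maximal , t₁∩t₂=∅ , dt₁ , dt₂) ∷ drest
    ; separate    = All.zipWith (λ (t₁∩s , t₂∩s) → ∪-disjoint t₁∩s t₂∩s) (t₁∩ , t₂∩) ∷ rest∩
    ; spanning    = λ x → span (Any-resp-↭ f↭ (spanning isForest x))
    }
    where
    span : ∀ {x rest} → Any (λ t → x ∈ˢ points t) (t₁ ∷ t₂ ∷ rest) →
           Any (λ t → x ∈ˢ points t) (node t₁ t₂ ∷ rest)
    span (here x∈t₁)         = here (p⊆p∪q (points t₂) x∈t₁)
    span (there (here x∈t₂)) = here (q⊆p∪q (points t₁) (points t₂) x∈t₂)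
    span (there (there x∈))  = there x∈

  leaves-forest : IsDendrogramForest (map leaf (allFin n))
  leaves-forest = record
    { dendrograms = All.map⁺ (All.universal (λ _ → tt) (allFin n))
    ; separate    = AllPairs.map⁺ (AllPairs.map ≢⇒disjoint (allFin⁺ n))
    ; spanning    = λ x → Any.map⁺ (Any.map (λ { refl → x∈⁅x⁆ x }) (∈-allFin x))
    }
    where
    ≢⇒disjoint : ∀ {x y : Fin n} → x ≢ y → Disjoint ⁅ x ⁆ ⁅ y ⁆
    ≢⇒disjoint {x} {y} x≢y = ∉⇒disjoint λ z∈x z∈y →
      x≢y (trans (sym (x∈⁅y⁆⇒x≡y x z∈x)) (x∈⁅y⁆⇒x≡y y z∈y))

  links-forest : ∀ {f f′} → IsDendrogramForest f → Star _⟶_ f f′ → IsDendrogramForest f′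
  links-forest isForest ε             = isForest
  links-forest isForest (step ◅ steps) = links-forest (link-forest isForest step) steps

  average-linkage-dendrogram : ∀ {T} → IsAverageLinkageTree T → Dendrogram T × (∀ x → x ∈ˢ points T)
  average-linkage-dendrogram steps with links-forest leaves-forest steps
  ... | isForest with dendrograms isForest
  ...   | dT ∷ [] = dT , λ x → Any.singleton⁻ (spanning isForest x)

-- The interactive process

distinct⇒2≤n : ∀ {n} {A B : Subset n} → Nonempty A → Nonempty B → A ≢ B → 2 ℕ.≤ n
distinct⇒2≤n {zero}        (() , _) _ _
distinct⇒2≤n {suc (suc n)} _ _ _ = s≤s (s≤s z≤n)
distinct⇒2≤n {suc zero} {inside  ∷ []} {inside  ∷ []} _ _ A≢B = ⊥-elim (A≢B refl)
distinct⇒2≤n {suc zero} {outside ∷ []} {_}            (zero , ()) _ _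
distinct⇒2≤n {suc zero} {inside  ∷ []} {outside ∷ []} _ (zero , ()) _

-- Nonemptiness matters here: the empty set is disjoint from itself and could be repeated.
disjoint⇒unique : ∀ {n} {P : List (Subset n)} → All Nonempty P → AllPairs Disjoint P → Unique P
disjoint⇒unique []            []            = []
disjoint⇒unique ((x , x∈A) ∷ ne) (A∩ ∷ disj) =
  All.map (λ { A∩A=∅ refl → disjoint⇒∉ A∩A=∅ x∈A x∈A }) A∩ ∷ disjoint⇒unique ne disj

module Process {c ℓ₁ ℓ₂ : Level} (F : OrderedField c ℓ₁ ℓ₂) {n : ℕ} (C* : Clustering n)
  (T : Tree n) (dendrogram : Laminarity.Dendrogram C* T) (T-full : ∀ x → x ∈ˢ points T)
  (η : OrderedField.Carrier F) (½<η : OrderedField._<_ F (OrderedField.½ F) η)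
  (η<1 : OrderedField._<_ F η (OrderedField.1# F)) where
  open OrderedField F
  open OrderedFieldProperties F
  open MergeRatio ½<η η<1
  open Logarithm 2≤b
  open Laminarity C*
  open Dendrograms C*
  open MergeModel F C* T η

  private
    Q = clusters C*

  Inside : Subset n → Set
  Inside A = ∃[ q ] q ∈ Q × A ⊆ q

  record Invariant (σ : State n) : Set where
    field
      nonempties : All (Nonempty ∘ proj₁) σ
      separate   : AllPairs (λ c c′ → Disjoint (proj₁ c) (proj₁ c′)) σ
      spanning   : ∀ x → Any (λ c → x ∈ˢ proj₁ c) σ
      pures      : All (λ c → proj₂ c ≡ pure → Inside (proj₁ c)) σ

  open Invariant

  Invariant-resp-↭ : ∀ {σ σ′} → σ ↭ σ′ → Invariant σ → Invariant σ′
  Invariant-resp-↭ σ↭ inv = record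
    { nonempties = All-resp-↭ σ↭ (nonempties inv)
    ; separate   = AllPairs-resp-↭ Disjoint-sym σ↭ (separate inv)
    ; spanning   = λ x → Any-resp-↭ σ↭ (spanning inv x)
    ; pures      = All-resp-↭ σ↭ (pures inv)
    }

  -- The contribution of one cluster to the distance to `C*`, stated for labelled clusters because
  -- the states of a run are lists of these and not values of `Clustering`.
  error : LabelledCluster n → ℕ
  error (C , _) = cells Q C ∸ 1

  -- A pure cluster can take part in one more merge before it is absorbed; an
  -- impure one in at most level ∣ C ∣ merges for each target cluster it meets.
  weight : LabelledCluster n → ℕ
  weight (C , pure)   = cells Q C
  weight (C , impure) = cells Q C ℕ.* level ∣ C ∣

  Σ-resp-↭ : ∀ (f : LabelledCluster n → ℕ) {σ σ′} → σ ↭ σ′ → Σ f σ ≡ Σ f σ′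
  Σ-resp-↭ f σ↭ = sum-↭ (map⁺ f σ↭)

  η≤threshold : ∀ l → η ≤ threshold l
  η≤threshold pure   = <⇒≤ η<1
  η≤threshold impure = ≤-refl

  threshold≤1 : ∀ l → threshold l ≤ 1#
  threshold≤1 pure   = ≤-refl
  threshold≤1 impure = <⇒≤ η<1

  Covers-weaken : ∀ {θ θ′} A C → θ ≤ θ′ → Covers θ′ A C → Covers θ A C
  Covers-weaken A C θ≤θ′ covers = ≤-trans (*-monoʳ-≤ (fromℕ-nonneg ∣ C ∣) θ≤θ′) covers

  Covers⇒Coversη : ∀ l A C → Covers (threshold l) A C → Covers η A C
  Covers⇒Coversη l A C = Covers-weaken A C (η≤threshold l)

  ⊆⇒Covers1 : ∀ {A C} → C ⊆ A → Covers 1# A C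
  ⊆⇒Covers1 {A} {C} C⊆A rewrite p⊆q⇒q∩p≡p C A C⊆A = ≈⇒≤ (*-identityˡ _)

  Covers1⇒⊆ : ∀ {A C} → Covers 1# A C → C ⊆ A
  Covers1⇒⊆ {A} {C} covers =
    ∣p∣≤∣q∩p∣⇒p⊆q C A (fromℕ-cancel-≤ (≤-trans (≈⇒≤ (≈-sym (*-identityˡ _))) covers))

  Coversη⇒nonempty : ∀ {A C} → Nonempty C → Covers η A C → Nonempty (A ∩ C)
  Coversη⇒nonempty {A} {C} C≠∅ covers = 1≤∣p∣⇒nonempty (A ∩ C) (positive
    (<-≤-trans (*-pos 0<η (fromℕ-pos (nonempty⇒1≤∣p∣ C≠∅))) covers))
    where
    positive : ∀ {m} → 0# < fromℕ m → 1 ℕ.≤ m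
    positive {zero}  0<0 = ⊥-elim (irrefl ≈-refl 0<0)
    positive {suc m} _   = s≤s z≤n

  Coversη-overlap : ∀ {A B C} → Nonempty C → Covers η A C → Covers η B C → Nonempty (A ∩ B)
  Coversη-overlap {A} {B} {C} C≠∅ A-covers B-covers with nonempty? (A ∩ B)
  ... | yes A∩B≠∅ = A∩B≠∅
  ... | no  A∩B=∅ = ⊥-elim (ℕ.<⇒≱ (two-majorities {∣ A ∩ C ∣} {∣ B ∩ C ∣} (nonempty⇒1≤∣p∣ C≠∅) A-covers B-covers)
                                   (disjoint⇒∣p∩r∣+∣q∩r∣≤∣r∣ A B C A∩B=∅))

  inside-of : ∀ {A q x} → Inside A → q ∈ Q → x ∈ˢ q → x ∈ˢ A → A ⊆ q
  inside-of (q′ , q′∈ , A⊆q′) q∈ x∈q x∈A with cluster-unique C* q∈ q′∈ x∈q (A⊆q′ x∈A)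
  ... | refl = A⊆q′

  -- The oracle guarantees only an `η`-fraction, while the procedure asks a pure cluster to be
  -- covered whole. A pure cluster lies inside some target, and an `η`-fraction in `q` makes it meet
  -- `q`, so that target is `q`.
  target-covers : ∀ {C l q} → Nonempty C → (l ≡ pure → Inside C) → q ∈ Q →
                  Covers η q C → Covers (threshold l) q C
  target-covers {l = impure} _ _ _ covers = covers
  target-covers {C} {pure} {q} C≠∅ within q∈ covers with Coversη⇒nonempty C≠∅ covers
  ... | x , x∈ with x∈p∩q⁻ q C x∈
  ...   | x∈q , x∈C = ⊆⇒Covers1 (inside-of (within refl) q∈ x∈q x∈C)

  MergeNode : LabelledCluster n → LabelledCluster n → Subset n → Set (ℓ₁ ⊔ ℓ₂)
  MergeNode (C₁ , l₁) (C₂ , l₂) P = Covers (threshold l₁) P C₁ × Covers (threshold l₂) P C₂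

  -- The target q is itself a node that qualifies for the merge, and it overlaps N
  -- in C₁; as N is at least as deep as q, it lies inside q.
  mergeNode⊆target : ∀ {C₁ l₁ C₂ l₂ q N} → Nonempty C₁ → Nonempty C₂ →
                     (l₁ ≡ pure → Inside C₁) → (l₂ ≡ pure → Inside C₂) →
                     q ∈ Q → Covers η q C₁ → Covers η q C₂ →
                     IsDeepest T (MergeNode (C₁ , l₁) (C₂ , l₂)) N → points N ⊆ q
  mergeNode⊆target {C₁} {l₁} {C₂} {l₂} {q} {N} C₁≠∅ C₂≠∅ within₁ within₂ q∈ covers₁ covers₂
    (d , at , (N-covers₁ , _) , max) with cluster-is-node dendrogram T-full q∈
  ... | dq , Nq , atq , refl with Coversη-overlap {B = q} C₁≠∅ (Covers⇒Coversη l₁ (points N) C₁ N-covers₁) covers₁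
  ...   | x , x∈ with x∈p∩q⁻ (points N) q x∈
  ...     | x∈N , x∈q = deeper⇒⊆ dendrogram at atq
                (max dq Nq atq (target-covers C₁≠∅ within₁ q∈ covers₁ , target-covers C₂≠∅ within₂ q∈ covers₂))
                x∈N x∈q

  -- For a pure cluster the threshold 1 forces `C ⊆ P`, and the empty remainder has weight 0. For an
  -- impure one the level falls, and the number of targets met does not grow.
  weight-decreases : ∀ {C l P} → Nonempty C → Covers (threshold l) P C →
                     weight (C ─ P , l) ℕ.< weight (C , l)
  weight-decreases {C} {pure} {P} C≠∅ covers
    rewrite cells-empty {Q = Q} {C ─ P} (λ (x , x∈) → x∈p─q⇒x∉q C P x∈ (Covers1⇒⊆ covers (p─q⊆p C P x∈))) =
    cells-pos (covering C*) C≠∅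
  weight-decreases {C} {impure} {P} C≠∅ covers = begin-strict
    cells Q (C ─ P) ℕ.* level ∣ C ─ P ∣ ≤⟨ ℕ.*-monoˡ-≤ (level ∣ C ─ P ∣) (cells-mono {Q = Q} (p─q⊆p C P)) ⟩
    cells Q C ℕ.* level ∣ C ─ P ∣       <⟨ ℕ.*-monoʳ-< (cells Q C) {{ℕ.>-nonZero (cells-pos (covering C*) C≠∅)}} shrinks ⟩
    cells Q C ℕ.* level ∣ C ∣           ∎
    where
    open ℕ.≤-Reasoning
    shrinks : level ∣ C ─ P ∣ ℕ.< level ∣ C ∣
    shrinks = b*s≤t⇒level-< ∣ C ─ P ∣ ∣ C ∣ (nonempty⇒1≤∣p∣ C≠∅)
      (b*rest≤ {∣ P ∩ C ∣} (trans (cong (λ A → ∣ A ∣ ℕ.+ ∣ C ─ P ∣) (∩-comm P C)) (∣p∩q∣+∣p─q∣≡∣p∣ C P)) covers)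

  -- The effect of a split

  split-invariant : ∀ {C l rest A B} → Invariant ((C , l) ∷ rest) → C ⊆ A ∪ B → Disjoint A B →
                    Nonempty (C ∩ A) → Nonempty (C ∩ B) →
                    Invariant ((C ∩ A , impure) ∷ (C ∩ B , impure) ∷ rest)
  split-invariant {C} {l} {rest} {A} {B} inv C⊆A∪B A∩B=∅ C∩A≠∅ C∩B≠∅
    with _ ∷ ne ← nonempties inv | C∩ ∷ disj ← separate inv | _ ∷ pu ← pures inv = record
    { nonempties = C∩A≠∅ ∷ C∩B≠∅ ∷ ne
    ; separate   = (∉⇒disjoint (λ x∈A x∈B → disjoint⇒∉ A∩B=∅ (p∩q⊆q C A x∈A) (p∩q⊆q C B x∈B)) ∷ part A)
                   ∷ part B ∷ disj
    ; spanning   = λ x → span (spanning inv x)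
    ; pures      = (λ ()) ∷ (λ ()) ∷ pu
    }
    where
    part : ∀ A → All (λ c → Disjoint (C ∩ A) (proj₁ c)) rest
    part A = All.map (λ C∩c=∅ → ∉⇒disjoint λ x∈ → disjoint⇒∉ C∩c=∅ (p∩q⊆p C A x∈)) (AllPairs.head (separate inv))
    span : ∀ {x} → Any (λ c → x ∈ˢ proj₁ c) ((C , l) ∷ rest) →
           Any (λ c → x ∈ˢ proj₁ c) ((C ∩ A , impure) ∷ (C ∩ B , impure) ∷ rest)
    span (there x∈)  = there (there x∈)
    span (here  x∈C) with x∈p∪q⁻ A B (C⊆A∪B x∈C)
    ... | inj₁ x∈A = here (x∈p∩q⁺ (x∈C , x∈A))
    ... | inj₂ x∈B = there (here (x∈p∩q⁺ (x∈C , x∈B)))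

  two-targets⇒¬Inside : ∀ {C A B} → A ∈ Q → B ∈ Q → A ≢ B → Nonempty (C ∩ A) → Nonempty (C ∩ B) → ¬ Inside C
  two-targets⇒¬Inside {C} {A} {B} A∈ B∈ A≢B (x , x∈) (y , y∈) (q , q∈ , C⊆q)
    with x∈p∩q⁻ C A x∈ | x∈p∩q⁻ C B y∈
  ... | x∈C , x∈A | y∈C , y∈B =
    A≢B (trans (cluster-unique C* A∈ q∈ x∈A (C⊆q x∈C)) (cluster-unique C* q∈ B∈ (C⊆q y∈C) y∈B))

  split-step : ∀ {σ σ′ r} → Invariant σ → Allowed σ (split r) → Response σ (split r) σ′ →
               Invariant σ′ × suc (Σ error σ′) ℕ.≤ Σ error σ × Σ weight σ′ ℕ.≤ Σ weight σ
  split-step {σ} {σ′} inv (split {A = A} {B} C∈σ A∈ B∈ A≢B C∩A≠∅ C∩B≠∅)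
    (split {C} {l} {rest} {N₁} {N₂} σ↭ deep@(d , at , C⊆N , _)) =
      split-invariant (Invariant-resp-↭ σ↭ inv) C⊆N N₁∩N₂=∅ C₁≠∅ C₂≠∅
    , subst (suc (Σ error σ′) ℕ.≤_) (sym (Σ-resp-↭ error σ↭)) error-decreases
    , subst (Σ weight σ′ ℕ.≤_) (sym (Σ-resp-↭ weight σ↭)) (weight-bound l within)
    where
    C₁ = C ∩ points N₁
    C₂ = C ∩ points N₂
    C₁≠∅ = proj₁ (deepest-meets-children deep)
    C₂≠∅ = proj₂ (deepest-meets-children deep)
    N-dendrogram = Dendrogram-subtree dendrogram at
    N₁∩N₂=∅ = proj₁ (proj₂ N-dendrogram)

    ¬inside : ¬ Inside C
    ¬inside = two-targets⇒¬Inside A∈ B∈ A≢B C∩A≠∅ C∩B≠∅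

    within : l ≡ pure → Inside C
    within = All.head (All-resp-↭ σ↭ (pures inv))

    -- A target meeting both parts would straddle the two children, hence contain the node and with
    -- it `C`; but `C` meets two targets.
    separated : ∀ {q} → q ∈ Q → Disjoint q C₁ ⊎ Disjoint q C₂
    separated {q} q∈ with nonempty? (q ∩ C₁) | nonempty? (q ∩ C₂)
    ... | no q∩C₁=∅ | _          = inj₁ q∩C₁=∅
    ... | yes _     | no  q∩C₂=∅ = inj₂ q∩C₂=∅
    ... | yes (x , x∈) | yes (y , y∈) = ⊥-elim (¬inside (q , q∈ , λ x∈C →
            straddling⇒⊇ N-dendrogram q∈ (x , shrink N₁ x∈) (y , shrink N₂ y∈) (C⊆N x∈C)))
      where
      shrink : ∀ N {x} → x ∈ˢ q ∩ (C ∩ points N) → x ∈ˢ q ∩ points N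
      shrink N x∈ with x∈p∩q⁻ q (C ∩ points N) x∈
      ... | x∈q , x∈CN = x∈p∩q⁺ (x∈q , p∩q⊆q C (points N) x∈CN)

    cells-split : cells Q C₁ ℕ.+ cells Q C₂ ℕ.≤ cells Q C
    cells-split = cells-separated (p∩q⊆p C (points N₁)) (p∩q⊆p C (points N₂)) separated

    -- Each part meets at least one target, so no subtraction is truncated, and `c₁ + c₂ ≤ c` gives
    -- `1 + (c₁ - 1) + (c₂ - 1) ≤ c - 1`.
    error-decreases : suc (Σ error σ′) ℕ.≤ error (C , l) ℕ.+ Σ error rest
    error-decreases = go (cells-pos (covering C*) C₁≠∅) (cells-pos (covering C*) C₂≠∅) cells-split
      where
      go : ∀ {c₁ c₂ c e} → 1 ℕ.≤ c₁ → 1 ℕ.≤ c₂ → c₁ ℕ.+ c₂ ℕ.≤ c →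
           suc ((c₁ ∸ 1) ℕ.+ ((c₂ ∸ 1) ℕ.+ e)) ℕ.≤ (c ∸ 1) ℕ.+ e
      go {suc c₁} {suc c₂} {suc c} {e} _ _ (s≤s c₁+c₂≤c) = begin
        suc (c₁ ℕ.+ (c₂ ℕ.+ e)) ≡⟨ cong suc (ℕ.+-assoc c₁ c₂ e) ⟨
        suc (c₁ ℕ.+ c₂) ℕ.+ e   ≡⟨ cong (ℕ._+ e) (ℕ.+-suc c₁ c₂) ⟨
        c₁ ℕ.+ suc c₂ ℕ.+ e     ≤⟨ ℕ.+-monoˡ-≤ e c₁+c₂≤c ⟩
        c ℕ.+ e                 ∎
        where open ℕ.≤-Reasoning

    -- A pure cluster lies inside one target and can never be split. For an impure one, the targets
    -- met are divided between the parts and neither part has a higher level than `C`.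
    weight-bound : ∀ l → (l ≡ pure → Inside C) → Σ weight σ′ ℕ.≤ weight (C , l) ℕ.+ Σ weight rest
    weight-bound pure   within = ⊥-elim (¬inside (within refl))
    weight-bound impure _      = begin
      w₁ ℕ.+ (w₂ ℕ.+ Σ weight rest)                    ≡⟨ ℕ.+-assoc w₁ w₂ _ ⟨
      w₁ ℕ.+ w₂ ℕ.+ Σ weight rest                      ≤⟨ ℕ.+-monoˡ-≤ _ (ℕ.+-mono-≤ (part N₁) (part N₂)) ⟩
      cells Q C₁ ℕ.* h ℕ.+ cells Q C₂ ℕ.* h ℕ.+ Σ weight rest
        ≡⟨ cong (ℕ._+ Σ weight rest) (ℕ.*-distribʳ-+ h (cells Q C₁) (cells Q C₂)) ⟨
      (cells Q C₁ ℕ.+ cells Q C₂) ℕ.* h ℕ.+ Σ weight rest ≤⟨ ℕ.+-monoˡ-≤ _ (ℕ.*-monoˡ-≤ h cells-split) ⟩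
      cells Q C ℕ.* h ℕ.+ Σ weight rest                ∎
      where
      open ℕ.≤-Reasoning
      h = level ∣ C ∣
      w₁ = weight (C₁ , impure)
      w₂ = weight (C₂ , impure)
      part : ∀ N → cells Q (C ∩ points N) ℕ.* level ∣ C ∩ points N ∣ ℕ.≤ cells Q (C ∩ points N) ℕ.* h
      part N = ℕ.*-monoʳ-≤ (cells Q (C ∩ points N)) (level-mono-≤ (p⊆q⇒∣p∣≤∣q∣ (p∩q⊆p C (points N))))

  -- The effect of a merge

  remainders : Subset n → LabelledCluster n → LabelledCluster n → State n
  remainders P (C₁ , l₁) (C₂ , l₂) = discardEmpty ((C₁ ─ P , l₁) ∷ (C₂ ─ P , l₂) ∷ [])

  -- Discarding entries can only lower a sum of natural numbers, so the bounds may treat both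
  -- remainders as present, empty or not.
  Σ-merged : ∀ (f : LabelledCluster n → ℕ) {C₁ l₁ C₂ l₂ P rest} →
             Σ f (remainders P (C₁ , l₁) (C₂ , l₂) ++ rest)
             ℕ.≤ f (C₁ ─ P , l₁) ℕ.+ (f (C₂ ─ P , l₂) ℕ.+ Σ f rest)
  Σ-merged f {C₁} {l₁} {C₂} {l₂} {P} {rest} = begin
    Σ f (discardEmpty σ ++ rest)            ≡⟨ cong sum (map-++ f (discardEmpty σ) rest) ⟩
    sum (map f (discardEmpty σ) ++ map f rest) ≡⟨ sum-++ (map f (discardEmpty σ)) (map f rest) ⟩
    Σ f (discardEmpty σ) ℕ.+ Σ f rest       ≤⟨ ℕ.+-monoˡ-≤ (Σ f rest) (Σ-filter (λ c → nonempty? (proj₁ c)) f σ) ⟩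
    Σ f σ ℕ.+ Σ f rest                      ≡⟨ sum-++ (map f σ) (map f rest) ⟨
    f (C₁ ─ P , l₁) ℕ.+ (f (C₂ ─ P , l₂) ℕ.+ Σ f rest) ∎
    where
    open ℕ.≤-Reasoning
    σ = (C₁ ─ P , l₁) ∷ (C₂ ─ P , l₂) ∷ []

  merge-invariant : ∀ {C₁ l₁ C₂ l₂ rest P} → Invariant ((C₁ , l₁) ∷ (C₂ , l₂) ∷ rest) →
                    Nonempty (P ∩ C₁) → Inside P →
                    Invariant ((P ∩ (C₁ ∪ C₂) , pure) ∷ remainders P (C₁ , l₁) (C₂ , l₂) ++ rest)
  merge-invariant {C₁} {l₁} {C₂} {l₂} {rest} {P} inv (z , z∈) (q , q∈ , P⊆q)
    with _ ∷ _ ∷ ne ← nonempties inv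
       | (C₁∩C₂=∅ ∷ C₁∩) ∷ C₂∩ ∷ disj ← separate inv
       | pu₁ ∷ pu₂ ∷ pu ← pures inv = record
    { nonempties = (z , x∈p∩q⁺ (p∩q⊆p P C₁ z∈ , p⊆p∪q C₂ (p∩q⊆q P C₁ z∈)))
                   ∷ All.++⁺ (All.all-filter nonempty₁? residues) ne
    ; separate   = All.++⁺ (All.filter⁺ nonempty₁? (outside-P C₁ ∷ outside-P C₂ ∷ []))
                           (All.zipWith (λ (C₁∩c=∅ , C₂∩c=∅) → ⊆-disjoint (p∩q⊆q P (C₁ ∪ C₂)) (∪-disjoint C₁∩c=∅ C₂∩c=∅)) (C₁∩ , C₂∩))
                   ∷ AllPairs.++⁺ (AllPairs.filter⁺ nonempty₁? (((remainders-disjoint C₁∩C₂=∅) ∷ []) ∷ [] ∷ [])) disj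
                       (All.filter⁺ nonempty₁? (All.map (⊆-disjoint (p─q⊆p C₁ P)) C₁∩
                                                ∷ All.map (⊆-disjoint (p─q⊆p C₂ P)) C₂∩ ∷ []))
    ; spanning   = λ x → span (spanning inv x)
    ; pures      = (λ _ → q , q∈ , λ x∈ → P⊆q (p∩q⊆p P (C₁ ∪ C₂) x∈))
                   ∷ All.++⁺ (All.filter⁺ nonempty₁? (shrink pu₁ ∷ shrink pu₂ ∷ [])) pu
    }
    where
    residues = (C₁ ─ P , l₁) ∷ (C₂ ─ P , l₂) ∷ []
    nonempty₁? : ∀ (c : LabelledCluster n) → Dec (Nonempty (proj₁ c))
    nonempty₁? c = nonempty? (proj₁ c)
    ⊆-disjoint : ∀ {A B D : Subset n} → A ⊆ B → Disjoint B D → Disjoint A D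
    ⊆-disjoint A⊆B B∩D=∅ = ∉⇒disjoint λ x∈A → disjoint⇒∉ B∩D=∅ (A⊆B x∈A)
    remainders-disjoint : Disjoint C₁ C₂ → Disjoint (C₁ ─ P) (C₂ ─ P)
    remainders-disjoint C₁∩C₂=∅ = ⊆-disjoint (p─q⊆p C₁ P) (Disjoint-sym (⊆-disjoint (p─q⊆p C₂ P) (Disjoint-sym C₁∩C₂=∅)))
    outside-P : ∀ C → Disjoint (P ∩ (C₁ ∪ C₂)) (C ─ P)
    outside-P C = ∉⇒disjoint λ x∈ x∈C─P → x∈p─q⇒x∉q C P x∈C─P (p∩q⊆p P (C₁ ∪ C₂) x∈)
    shrink : ∀ {C l} → (l ≡ pure → Inside C) → l ≡ pure → Inside (C ─ P)
    shrink {C} within l≡pure with within l≡pure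
    ... | r , r∈ , C⊆r = r , r∈ , λ x∈ → C⊆r (p─q⊆p C P x∈)
    Spanned = λ x → Any (λ (c : LabelledCluster n) → x ∈ˢ proj₁ c)
    keep : ∀ {c x} → c ∈ residues → x ∈ˢ proj₁ c → Spanned x (discardEmpty residues ++ rest)
    keep c∈ x∈c = lose (∈-++⁺ˡ (∈-filter⁺ nonempty₁? c∈ (_ , x∈c))) x∈c
    span : ∀ {x} → Spanned x ((C₁ , l₁) ∷ (C₂ , l₂) ∷ rest) →
           Spanned x ((P ∩ (C₁ ∪ C₂) , pure) ∷ discardEmpty residues ++ rest)
    span (there (there x∈)) = there (Any.++⁺ʳ (discardEmpty residues) x∈)
    span {x} (here x∈C₁) with x ∈? P
    ... | yes x∈P = here (x∈p∩q⁺ (x∈P , p⊆p∪q C₂ x∈C₁))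
    ... | no  x∉P = there (keep (here refl) (x∈p∧x∉q⇒x∈p─q x∈C₁ x∉P))
    span {x} (there (here x∈C₂)) with x ∈? P
    ... | yes x∈P = here (x∈p∩q⁺ (x∈P , q⊆p∪q C₁ C₂ x∈C₂))
    ... | no  x∉P = there (keep (there (here refl)) (x∈p∧x∉q⇒x∈p─q x∈C₂ x∉P))

  merge-step : ∀ {σ σ′ r₁ r₂} → Invariant σ → Allowed σ (merge r₁ r₂) → Response σ (merge r₁ r₂) σ′ →
               Invariant σ′ × Σ error σ′ ℕ.≤ Σ error σ × suc (Σ weight σ′) ℕ.≤ Σ weight σ
  merge-step {σ} {σ′} inv (merge _ _ _ q∈ covers₁ covers₂)
    (merge {C₁} {l₁} {C₂} {l₂} {rest} {N} σ↭ deep@(_ , _ , (N-covers₁ , N-covers₂) , _)) =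
      merge-invariant inv′ (Coversη⇒nonempty C₁≠∅ (Covers⇒Coversη l₁ (points N) C₁ N-covers₁)) (_ , q∈ , P⊆q)
    , subst (Σ error σ′ ℕ.≤_) (sym (Σ-resp-↭ error σ↭)) error-bound
    , subst (suc (Σ weight σ′) ℕ.≤_) (sym (Σ-resp-↭ weight σ↭)) weight-bound
    where
    inv′ = Invariant-resp-↭ σ↭ inv
    C₁≠∅ = All.head (nonempties inv′)
    C₂≠∅ = All.head (All.tail (nonempties inv′))
    P = points N
    D = P ∩ (C₁ ∪ C₂)
    P⊆q = mergeNode⊆target C₁≠∅ C₂≠∅ (All.head (pures inv′)) (All.head (All.tail (pures inv′)))
            q∈ covers₁ covers₂ deep

    cells-D≤1 : cells Q D ℕ.≤ 1
    cells-D≤1 = cells-⊆ (disjoint C*) q∈ (λ x∈ → P⊆q (p∩q⊆p P (C₁ ∪ C₂) x∈))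

    error-bound : Σ error σ′ ℕ.≤ error (C₁ , l₁) ℕ.+ (error (C₂ , l₂) ℕ.+ Σ error rest)
    error-bound = begin
      error (D , pure) ℕ.+ Σ error (remainders P (C₁ , l₁) (C₂ , l₂) ++ rest)
        ≤⟨ ℕ.+-mono-≤ (ℕ.∸-monoˡ-≤ 1 cells-D≤1) (Σ-merged error) ⟩
      error (C₁ ─ P , l₁) ℕ.+ (error (C₂ ─ P , l₂) ℕ.+ Σ error rest)
        ≤⟨ ℕ.+-mono-≤ (part C₁) (ℕ.+-monoˡ-≤ (Σ error rest) (part C₂)) ⟩
      error (C₁ , l₁) ℕ.+ (error (C₂ , l₂) ℕ.+ Σ error rest) ∎
      where
      open ℕ.≤-Reasoning
      part : ∀ C → cells Q (C ─ P) ∸ 1 ℕ.≤ cells Q C ∸ 1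
      part C = ℕ.∸-monoˡ-≤ 1 (cells-mono {Q = Q} (p─q⊆p C P))

    -- Of the two units lost by `C₁` and `C₂`, one pays for the new pure cluster and the other for
    -- the request.
    weight-bound : suc (Σ weight σ′) ℕ.≤ weight (C₁ , l₁) ℕ.+ (weight (C₂ , l₂) ℕ.+ Σ weight rest)
    weight-bound = begin
      suc (weight (D , pure) ℕ.+ Σ weight (remainders P (C₁ , l₁) (C₂ , l₂) ++ rest))
        ≤⟨ s≤s (ℕ.+-mono-≤ cells-D≤1 (Σ-merged weight)) ⟩
      suc (suc (weight (C₁ ─ P , l₁) ℕ.+ (weight (C₂ ─ P , l₂) ℕ.+ Σ weight rest)))
        ≡⟨ cong suc (ℕ.+-suc (weight (C₁ ─ P , l₁)) _) ⟨
      suc (weight (C₁ ─ P , l₁)) ℕ.+ (suc (weight (C₂ ─ P , l₂)) ℕ.+ Σ weight rest)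
        ≤⟨ ℕ.+-mono-≤ (weight-decreases {l = l₁} C₁≠∅ N-covers₁)
                      (ℕ.+-monoˡ-≤ (Σ weight rest) (weight-decreases {l = l₂} C₂≠∅ N-covers₂)) ⟩
      weight (C₁ , l₁) ℕ.+ (weight (C₂ , l₂) ℕ.+ Σ weight rest) ∎
      where open ℕ.≤-Reasoning

  merge⇒2≤n : ∀ {σ r₁ r₂} → Invariant σ → Allowed σ (merge r₁ r₂) → 2 ℕ.≤ n
  merge⇒2≤n inv (merge C₁∈ C₂∈ C₁≢C₂ _ _ _) =
    distinct⇒2≤n (All.lookup (nonempties inv) C₁∈) (All.lookup (nonempties inv) C₂∈) C₁≢C₂

  -- Bounds along a run

  initial-invariant : ∀ C₀ → Invariant (initial C₀)
  initial-invariant C₀ = record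
    { nonempties = All.map⁺ (nonempty C₀)
    ; separate   = AllPairs.map⁺ (disjoint C₀)
    ; spanning   = λ x → Any.map⁺ (covering C₀ x)
    ; pures      = All.map⁺ (All.universal (λ _ ()) (clusters C₀))
    }

  -- Requests made so far plus the remaining potential stay below the initial potential, with
  -- `error` paying for splits and `weight` for merges. The last component serves the case `n ≤ 1`,
  -- where `⌈log_b n⌉` is 0 and the bound must say that no merge occurs.
  run-bounds : ∀ {C₀ s m σ} → Run C₀ s m σ →
               Invariant σ × s ℕ.+ Σ error σ ℕ.≤ Σ error (initial C₀)
                           × m ℕ.+ Σ weight σ ℕ.≤ Σ weight (initial C₀) × (m ≡ 0 ⊎ 2 ℕ.≤ n)
  run-bounds {C₀} start = initial-invariant C₀ , ℕ.≤-refl , ℕ.≤-refl , inj₁ refl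
  run-bounds {s = suc s} {m} (split run allowed response) with run-bounds run
  ... | inv , s+e≤ , m+w≤ , small with split-step inv allowed response
  ...   | inv′ , e′<e , w′≤w = inv′
          , ℕ.≤-trans (ℕ.≤-reflexive (sym (ℕ.+-suc s _))) (ℕ.≤-trans (ℕ.+-monoʳ-≤ s e′<e) s+e≤)
          , ℕ.≤-trans (ℕ.+-monoʳ-≤ m w′≤w) m+w≤
          , small
  run-bounds {s = s} {suc m} (merge run allowed response) with run-bounds run
  ... | inv , s+e≤ , m+w≤ , _ with merge-step inv allowed response
  ...   | inv′ , e′≤e , w′<w = inv′
          , ℕ.≤-trans (ℕ.+-monoʳ-≤ s e′≤e) s+e≤
          , ℕ.≤-trans (ℕ.≤-reflexive (sym (ℕ.+-suc m _))) (ℕ.≤-trans (ℕ.+-monoʳ-≤ m w′<w) m+w≤)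
          , inj₂ (merge⇒2≤n inv allowed)

  initial-error : ∀ C₀ → Σ error (initial C₀) ≡ dist C₀ C*
  initial-error C₀ = cong sum (sym (map-∘ (clusters C₀)))

  -- Once every cluster size is replaced by `n`, what remains is the number of meeting pairs of
  -- initial and target clusters; this is the origin of `δᵤ + k`.
  initial-weight : ∀ C₀ → Σ weight (initial C₀) ℕ.≤ (dist C* C₀ ℕ.+ # C*) ℕ.* level n
  initial-weight C₀ = begin
    Σ weight (initial C₀)                              ≡⟨ cong sum (map-∘ (clusters C₀)) ⟨
    Σ (λ C → cells Q C ℕ.* level ∣ C ∣) (clusters C₀)  ≤⟨ Σ-mono (clusters C₀) (λ {C} _ → ℕ.*-monoʳ-≤ (cells Q C) (level-mono-≤ (∣p∣≤n C))) ⟩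
    Σ (λ C → cells Q C ℕ.* level n) (clusters C₀)      ≡⟨ Σ-*ʳ (cells Q) (level n) (clusters C₀) ⟩
    Σ (cells Q) (clusters C₀) ℕ.* level n              ≤⟨ ℕ.*-monoˡ-≤ (level n) (Σ-cells≤dist+# C* C₀) ⟩
    (dist C* C₀ ℕ.+ # C*) ℕ.* level n                  ∎
    where open ℕ.≤-Reasoning

  -- Runs do not get stuck before the target

  respond : ∀ {σ} r → Invariant σ → Allowed σ r → ∃[ σ′ ] Response σ r σ′
  respond (split (C , l)) inv (split C∈σ A∈ B∈ A≢B C∩A≠∅ C∩B≠∅)
    with ∈⇒↭∷ C∈σ | deepest (C ⊆?_) T (λ {x} _ → T-full x)
  ... | rest , σ↭ | node N₁ N₂ , deep = _ , split σ↭ deep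
  -- A cluster inside a leaf lies in one target, so the split would not have been allowed.
  ... | rest , σ↭ | leaf x , _ , _ , C⊆x , _ with cluster-of C* x
  ...   | q , q∈ , x∈q = ⊥-elim (two-targets⇒¬Inside A∈ B∈ A≢B C∩A≠∅ C∩B≠∅
            (q , q∈ , λ y∈C → subst (_∈ˢ q) (sym (x∈⁅y⁆⇒x≡y x (C⊆x y∈C))) x∈q))
  respond (merge (C₁ , l₁) (C₂ , l₂)) inv (merge C₁∈σ C₂∈σ C₁≢C₂ _ _ _)
    with ∈⇒↭∷∷ C₁∈σ C₂∈σ (C₁≢C₂ ∘ cong proj₁)
       | deepest mergeNode? T (full l₁ C₁ , full l₂ C₂)
    where
    mergeNode? : ∀ P → Dec (MergeNode (C₁ , l₁) (C₂ , l₂) P)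
    mergeNode? P = (threshold l₁ * fromℕ ∣ C₁ ∣ ≤? fromℕ ∣ P ∩ C₁ ∣)
                   ×-dec (threshold l₂ * fromℕ ∣ C₂ ∣ ≤? fromℕ ∣ P ∩ C₂ ∣)
    -- The root contains every point and meets any pair of thresholds, so a deepest qualifying node
    -- exists.
    full : ∀ l C → Covers (threshold l) (points T) C
    full l C = Covers-weaken (points T) C (threshold≤1 l) (⊆⇒Covers1 λ {x} _ → T-full x)
  ... | rest , σ↭ | N , deep = _ , merge σ↭ deep

  -- Every cluster fills its target, since two clusters inside the same target coincide. Both lists
  -- are free of repetitions, so equal membership already makes them permutations of each other.
  finished : ∀ {σ} → Invariant σ → (∀ {c} → c ∈ σ → Inside (proj₁ c)) →
             (∀ {c c′ q} → c ∈ σ → c′ ∈ σ → q ∈ Q → proj₁ c ⊆ q → proj₁ c′ ⊆ q → proj₁ c ≡ proj₁ c′) →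
             σ is C*
  finished {σ} inv within injective = ∼bag⇒↭ (unique∧set⇒bag
    (disjoint⇒unique (All.map⁺ (nonempties inv)) (AllPairs.map⁺ (separate inv)))
    (disjoint⇒unique (nonempty C*) (disjoint C*))
    (mk⇔ to from))
    where
    is-target : ∀ {c q x} → c ∈ σ → q ∈ Q → x ∈ˢ proj₁ c → x ∈ˢ q → proj₁ c ≡ q
    is-target {c} {q} c∈ q∈ x∈c x∈q = ⊆-antisym c⊆q q⊆c
      where
      c⊆q = inside-of (within c∈) q∈ x∈q x∈c
      -- The cluster holding `y` meets `q`, hence lies inside `q`, hence is `c`.
      q⊆c : q ⊆ proj₁ c
      q⊆c {y} y∈q with find (spanning inv y)
      ... | c′ , c′∈ , y∈c′ rewrite injective c∈ c′∈ q∈ c⊆q (inside-of (within c′∈) q∈ y∈q y∈c′) = y∈c′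
    to : ∀ {A} → A ∈ map proj₁ σ → A ∈ Q
    to A∈ with ∈-map⁻ proj₁ A∈
    ... | c , c∈ , refl with All.lookup (nonempties inv) c∈
    ...   | x , x∈c with cluster-of C* x
    ...     | q , q∈ , x∈q = subst (_∈ Q) (sym (is-target c∈ q∈ x∈c x∈q)) q∈
    from : ∀ {q} → q ∈ Q → q ∈ map proj₁ σ
    from q∈ with All.lookup (nonempty C*) q∈
    ... | x , x∈q with find (spanning inv x)
    ...   | c , c∈ , x∈c = subst (_∈ map proj₁ σ) (is-target c∈ q∈ x∈c x∈q) (∈-map⁺ proj₁ c∈)

  -- A cluster inside no target permits a split, and two distinct clusters inside one target permit
  -- a merge; both searches are finite. With `respond` this turns the bounds into termination at the
  -- target: the number of requests is bounded, and a run that cannot be continued has reached `C*`.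
  progress : ∀ {σ} → Invariant σ → σ is C* ⊎ (∃[ r ] Allowed σ r)
  progress {σ} inv with any? (λ c → ¬? (any? (proj₁ c ⊆?_) Q)) σ
  ... | yes somewhere with find somewhere
  ...   | (C , l) , c∈ , ¬inside with All.lookup (nonempties inv) c∈
  ...     | x , x∈C with cluster-of C* x
  ...       | A , A∈ , x∈A with nonempty? (C ─ A)
  ...         | no  C─A=∅ = ⊥-elim (¬inside (lose A∈ (─-empty⇒⊆ C─A=∅)))
  ...         | yes (y , y∈) with cluster-of C* y
  ...           | B , B∈ , y∈B = inj₂ (split (C , l) , split c∈ A∈ B∈
                    (λ { refl → x∈p─q⇒x∉q C A y∈ y∈B })
                    (x , x∈p∩q⁺ (x∈C , x∈A)) (y , x∈p∩q⁺ (p─q⊆p C A y∈ , y∈B)))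
  progress {σ} inv | no nowhere
    with any? (λ c → any? (λ c′ → any? (λ q →
           ¬? (Vec.≡-dec Bool._≟_ (proj₁ c) (proj₁ c′)) ×-dec (proj₁ c ⊆? q) ×-dec (proj₁ c′ ⊆? q)) Q) σ) σ
  ... | yes two with find two
  ...   | (C₁ , l₁) , c₁∈ , two′ with find two′
  ...     | (C₂ , l₂) , c₂∈ , two″ with find two″
  ...       | q , q∈ , C₁≢C₂ , C₁⊆q , C₂⊆q = inj₂ (merge (C₁ , l₁) (C₂ , l₂) , merge c₁∈ c₂∈ C₁≢C₂ q∈
                (Covers-weaken q C₁ (<⇒≤ η<1) (⊆⇒Covers1 C₁⊆q)) (Covers-weaken q C₂ (<⇒≤ η<1) (⊆⇒Covers1 C₂⊆q)))
  progress {σ} inv | no nowhere | no ¬two = inj₁ (finished inv within injective)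
    where
    within : ∀ {c} → c ∈ σ → Inside (proj₁ c)
    within {c} c∈ with any? (proj₁ c ⊆?_) Q
    ... | yes found = find found
    ... | no  ¬found = ⊥-elim (nowhere (lose c∈ ¬found))
    injective : ∀ {c c′ q} → c ∈ σ → c′ ∈ σ → q ∈ Q → proj₁ c ⊆ q → proj₁ c′ ⊆ q → proj₁ c ≡ proj₁ c′
    injective {c} {c′} c∈ c′∈ q∈ c⊆q c′⊆q with Vec.≡-dec Bool._≟_ (proj₁ c) (proj₁ c′)
    ... | yes c≡c′ = c≡c′
    ... | no  c≢c′ = ⊥-elim (¬two (lose c∈ (lose c′∈ (lose q∈ (c≢c′ , c⊆q , c′⊆q)))))

theorem9 :
  {c ℓ₁ ℓ₂ : Level} (F : OrderedField c ℓ₁ ℓ₂) →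
  let open OrderedField F in
  (n : ℕ) (S : Fin n → Fin n → Carrier) →
  let open Similarity F S in
  Symmetric →
  (C* : Clustering n) → Stable C* →
  (T : Tree n) → IsAverageLinkageTree T →
  (η : Carrier) → ½ < η → η < 1# →
  (C₀ : Clustering n) →
  let open MergeModel F C* T η
      δᵤ = dist C* C₀
      δₒ = dist C₀ C*
      k  = # C*
      b  = (1# - η) ⁻¹
  in
  ∀ {s m σ} → Run C₀ s m σ →
    s ℕ.≤ δₒ
    × (1 ≤ 2 ·log[ b ] n → m ≤ 2 ℕ.* (δᵤ ℕ.+ k) ·log[ b ] n)
    × (∃[ L ] (L ≡⌈log[ b ] n ⌉) × m ℕ.≤ 2 ℕ.* (δᵤ ℕ.+ k) ℕ.* L)
    × (σ is C* ⊎ (∃[ r ] Allowed σ r))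
    × (∀ r → Allowed σ r → ∃[ σ′ ] Response σ r σ′)
theorem9 F n S symmetric C* stable T linkage η ½<η η<1 C₀ {s} {m} run =
    ℕ.≤-trans (ℕ.m≤m+n s _) (ℕ.≤-trans s+error≤ (ℕ.≤-reflexive (initial-error C₀)))
  , m≤M*level⇒m≤2M·log {n = n} M m≤M*level
  , (L , isLog , m≤M*level⇒m≤2M*⌈log⌉ M L m≡0⊎2≤n isLog m≤M*level)
  , progress invariant
  , λ r → respond r invariant
  where
  dendrogram = AverageLinkage.average-linkage-dendrogram F S symmetric C* stable linkage
  open Process F C* T (proj₁ dendrogram) (proj₂ dendrogram) η ½<η η<1
  open OrderedFieldProperties F
  open MergeRatio ½<η η<1 using (2≤b)
  open Logarithm 2≤b
  M = dist C* C₀ ℕ.+ # C*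
  bounds = run-bounds run
  invariant = proj₁ bounds
  s+error≤ = proj₁ (proj₂ bounds)
  m≡0⊎2≤n = proj₂ (proj₂ (proj₂ bounds))
  L = proj₁ (⌈log⌉ n)
  isLog = proj₂ (⌈log⌉ n)
  m≤M*level : m ℕ.≤ M ℕ.* level n
  m≤M*level = ℕ.≤-trans (ℕ.m≤m+n m _)
    (ℕ.≤-trans (proj₁ (proj₂ (proj₂ bounds))) (initial-weight C₀))
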